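{- Let $\mathcal H=\{\langle w_1\rangle,\dots,\langle w_T\rangle\}\subset\mathbf{RP}^n$ be a finite set of $T$ distinct points with $\mathrm{span}(w_1,\dots,w_T)=\mathbf R^{n+1}$, and let $p=(p_1,\dots,p_T)$ be a probability distribution on $\mathcal H$ ($p_i\ge0$, $\sum_i p_i=1$, $p_i$ the weight of $\langle w_i\rangle$). Then $$\eta^{\bigstar}_n(\mathcal H)=\sum_{W\in\mathcal H^{\times n}_{\ne0}}\frac{1-\sum_{j:\ \langle w_j\rangle\subset \mathrm{span}(W)}p_j}{W[\mathcal H]},$$ where for $W=(\langle w_{i_1}\rangle,\dots,\langle w_{i_n}\rangle)$, $\mathrm{span}(W)=\mathrm{span}(w_{i_1},\dots,w_{i_n})$ and the inner sum runs over all $j\in[T]$ with $\langle w_j\rangle$ contained in this span.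
   Context: $\mathbf{RP}^n$ is the set of $1$-dimensional subspaces of $\mathbf R^{n+1}$; $\langle v\rangle$ is the line spanned by $v\ne0$. For a finite $\mathcal H=\{\langle w_1\rangle,\dots,\langle w_T\rangle\}$ and an order (bijection) $\pi:[T]\to\mathcal H$, $\pi(i)=\langle w_i\rangle$, an ordered $n$-tuple $(\langle w_{i_1}\rangle,\dots,\langle w_{i_n}\rangle)$ of distinct elements satisfies the $\eta^\pi_n(\mathcal H)$ condition if (1) $2\le i_1<\dots<i_n\le T$, and (2) for every $l$, $\langle w_{i_l}\rangle$ is the $\pi$-minimal point of $\mathcal H$ contained in $\mathrm{span}(w_{i_l},\dots,w_{i_n})$. The number of such tuples with $w_{i_1},\dots,w_{i_n}$ linearly independent is known not to depend on $\pi$ and is denoted $\eta^{\bigstar}_n(\mathcal H)$. $\mathcal H^{\times n}_{\ne0}$ denotes the set of ordered $n$-tuples $W=(\langle w_{i_1}\rangle,\dots,\langle w_{i_n}\rangle)$ of distinct elements of $\mathcal H$ with $w_{i_1},\dots,w_{i_n}$ linearly independent. For such $W$ and $l=1,\dots,n$, let $q^W_l$ be the number of points of $\mathcal H$ contained in $\mathrm{span}(w_{i_{n-l+1}},\dots,w_{i_n})$ (the span of the last $l$ entries), and $W[\mathcal H]=q^W_n q^W_{n-1}\cdots q^W_1$. -}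

module Defs where

open import Data.Nat as ℕ using (ℕ; zero; suc; _∸_)
open import Data.Fin using (Fin; zero; suc; toℕ)
open import Data.Vec using (Vec; lookup)
open import Data.List using (List; length; map)
open import Data.List.Membership.Propositional using (_∈_)
open import Data.List.Relation.Unary.Unique.Propositional using (Unique)
open import Data.Product using (Σ; ∃; _×_; _,_)
open import Data.Sum using (_⊎_)
open import Data.Empty using (⊥)
open import Relation.Nullary using (¬_)
open import Relation.Binary.PropositionalEquality using (_≡_; _≢_)
open import Relation.Binary.Structures using (IsStrictTotalOrder)
open import Algebra.Structures using (IsCommutativeRing)
open import Function.Bundles using (_⇔_)

-- The real numbers, axiomatised as a complete ordered field
-- (any model is isomorphic to ℝ).

record RealField : Set₁ where
  infixl 6 _+_
  infixl 7 _*_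
  infix 4 _<_ _≤_
  field
    Carrier : Set
    0# 1#   : Carrier
    _+_ _*_ : Carrier → Carrier → Carrier
    -_      : Carrier → Carrier
    _<_     : Carrier → Carrier → Set
    isCommutativeRing : IsCommutativeRing _≡_ _+_ _*_ -_ 0# 1#
    0≢1     : 0# ≢ 1#
    inverse : ∀ x → x ≢ 0# → ∃ λ y → x * y ≡ 1#
    isStrictTotalOrder : IsStrictTotalOrder _≡_ _<_
    +-mono-< : ∀ {x y} z → x < y → x + z < y + z
    *-pos    : ∀ {x y} → 0# < x → 0# < y → 0# < x * y

  _≤_ : Carrier → Carrier → Set
  x ≤ y = x < y ⊎ x ≡ y

  field
    complete : (P : Carrier → Set) → (∃ λ x → P x) →
               (∃ λ b → ∀ x → P x → x ≤ b) →
               ∃ λ s → (∀ x → P x → x ≤ s) ×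
                       (∀ b → (∀ x → P x → x ≤ b) → s ≤ b)

-- Finite cardinalities and finite sums over (not necessarily decidable)
-- subsets, via duplicate-free exhaustive enumerations.

Enumerates : {A : Set} → (A → Set) → List A → Set
Enumerates {A} P xs = Unique xs × (∀ x → (x ∈ xs) ⇔ P x)

HasCard : {A : Set} → (A → Set) → ℕ → Set
HasCard {A} P k = Σ (List A) λ xs → Enumerates P xs × length xs ≡ k

∏ℕ : ∀ {n} → (Fin n → ℕ) → ℕ
∏ℕ {zero}  f = 1
∏ℕ {suc n} f = f zero ℕ.* ∏ℕ (λ i → f (suc i))

module Linear (ℝ : RealField) where
  open RealField ℝ public

  _-_ : Carrier → Carrier → Carrier
  x - y = x + (- y)

  fromℕ : ℕ → Carrier
  fromℕ zero    = 0#
  fromℕ (suc n) = 1# + fromℕ n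

  sumL : List Carrier → Carrier
  sumL Data.List.[] = 0#
  sumL (x Data.List.∷ xs) = x + sumL xs

  ∑ : ∀ {k} → (Fin k → Carrier) → Carrier
  ∑ {zero}  f = 0#
  ∑ {suc k} f = f zero + ∑ (λ i → f (suc i))

  IsSumOver : {A : Set} → (A → Set) → (A → Carrier) → Carrier → Set
  IsSumOver {A} P f s = Σ (List A) λ xs → Enumerates P xs × s ≡ sumL (map f xs)

  Vecℝ : ℕ → Set
  Vecℝ n = Fin (suc n) → Carrier

  IsZeroVec : ∀ {n} → Vecℝ n → Set
  IsZeroVec x = ∀ a → x a ≡ 0#

  InSpanOf : ∀ {n k} → (Fin k → Vecℝ n) → (Fin k → Set) → Vecℝ n → Set
  InSpanOf {n} {k} v S x =
    Σ (Fin k → Carrier) λ c → (∀ i → ¬ S i → c i ≡ 0#) ×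
                             (∀ a → x a ≡ ∑ (λ i → c i * v i a))

  InSpan : ∀ {n k} → (Fin k → Vecℝ n) → Vecℝ n → Set
  InSpan v x = InSpanOf v (λ _ → Data.Unit.⊤) x
    where import Data.Unit

  LinIndep : ∀ {n k} → (Fin k → Vecℝ n) → Set
  LinIndep {n} {k} v = ∀ (c : Fin k → Carrier) →
    (∀ a → ∑ (λ i → c i * v i a) ≡ 0#) → ∀ i → c i ≡ 0#

  -- A configuration H = {⟨w_1⟩,…,⟨w_T⟩} ⊂ RP^n of T distinct points,
  -- given by representatives w : Fin T → ℝ^(n+1) (index i : Fin T is the
  -- paper's index toℕ i + 1).

  DistinctPoints : ∀ {n T} → (Fin T → Vecℝ n) → Set
  DistinctPoints {n} {T} w =
    (∀ i → ¬ IsZeroVec (w i)) ×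
    (∀ i j → InSpan (λ (_ : Fin 1) → w i) (w j) → i ≡ j)

  -- An ordered n-tuple W of elements of H, as its index vector ι.
  entries : ∀ {n T} → (Fin T → Vecℝ n) → Vec (Fin T) n → Fin n → Vecℝ n
  entries w ι m = w (lookup ι m)

  InHxn≠0 : ∀ {n T} → (Fin T → Vecℝ n) → Vec (Fin T) n → Set
  InHxn≠0 {n} w ι =
    (∀ l m → lookup ι l ≡ lookup ι m → l ≡ m) × LinIndep (entries w ι)

  -- The η^π_n(H) condition for the order π(i) = ⟨w_i⟩.
  EtaCondition : ∀ {n T} → (Fin T → Vecℝ n) → Vec (Fin T) n → Set
  EtaCondition {n} {T} w ι =
    (∀ l → 1 ℕ.≤ toℕ (lookup ι l)) ×
    (∀ l m → toℕ l ℕ.< toℕ m → toℕ (lookup ι l) ℕ.< toℕ (lookup ι m)) ×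
    (∀ l (j : Fin T) →
       InSpanOf (entries w ι) (λ m → toℕ l ℕ.≤ toℕ m) (w j) →
       toℕ (lookup ι l) ℕ.≤ toℕ j)

  IsEtaStar : ∀ {n T} → (Fin T → Vecℝ n) → ℕ → Set
  IsEtaStar w k = HasCard (λ ι → EtaCondition w ι × InHxn≠0 w ι) k

  -- q^W_l for l = toℕ l' + 1: number of points of H in the span of the
  -- last l entries of W
  Is-q : ∀ {n T} → (Fin T → Vecℝ n) → Vec (Fin T) n → Fin n → ℕ → Set
  Is-q {n} w ι l' q =
    HasCard (λ j → InSpanOf (entries w ι) (λ m → n ∸ suc (toℕ l') ℕ.≤ toℕ m) (w j)) q

  IsTerm : ∀ {n T} → (Fin T → Vecℝ n) → (Fin T → Carrier) →
           Vec (Fin T) n → Carrier → Set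
  IsTerm {n} {T} w p ι t =
    Σ (Fin n → ℕ) λ q → (∀ l → Is-q w ι l (q l)) ×
    Σ Carrier λ P → IsSumOver (λ j → InSpan (entries w ι) (w j)) p P ×
    Σ Carrier λ invWH → invWH * fromℕ (∏ℕ q) ≡ 1# ×
    t ≡ (1# - P) * invWH

  IsRHS : ∀ {n T} → (Fin T → Vecℝ n) → (Fin T → Carrier) → Carrier → Set
  IsRHS {n} {T} w p s =
    Σ (List (Vec (Fin T) n)) λ Ws → Enumerates (InHxn≠0 w) Ws ×
    Σ (List Carrier) λ ts →
      Data.List.Relation.Binary.Pointwise.Pointwise (IsTerm w p) Ws ts ×
      s ≡ sumL ts
    where import Data.List.Relation.Binary.Pointwise

{-# OPTIONS --safe #-}
-- Fix a matroid on [T] and weigh an ordered basis W of a flat F by 1/W[H]. The ordered bases of F then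
-- have total weight |μ(F)|, because these totals satisfy Weisner's identity: for every point e of F,
-- |μ(F)| is the sum of |μ(G)| over the hyperplanes G of F that avoid e. To compare two points a and b of F,
-- split according to membership of the other point: the bases of a G that contains b but not a can be
-- lowered, by the identity one rank below, to flats K with a and b independent modulo K, and this is
-- symmetric in a and b. Averaging over a in F gives the weight 1/|F| of the first basis element.
-- Tuples satisfying the η condition are the no-broken-circuit bases W of the hyperplanes avoiding the first
-- point. Choosing for e the minimum of each flat in turn, Weisner's identity shows that they too are counted
-- by |μ|. In the top rank the total weight of the hyperplanes avoiding a point j does not depend on j, so η★
-- equals its p-average, which is the right-hand side.
module Submission where

open import Defs
open import Algebra.Bundles using (CommutativeRing)
import Algebra.Properties.CommutativeMonoid.Sum as CommutativeMonoidSum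
import Algebra.Properties.CommutativeSemigroup as CommutativeSemigroupProperties
import Algebra.Properties.Ring as RingProperties
import Algebra.Solver.Ring.NaturalCoefficients.Default as SemiringSolver
open import Data.Nat as ℕ using (ℕ; zero; suc)
import Data.Nat.Properties as ℕ
open import Data.Fin as Fin using (Fin; zero; suc; toℕ; opposite)
import Data.Fin.Permutation as Permutation
import Data.Fin.Properties as Fin
open import Data.List as List using (List; []; _∷_; _++_; map; length; filter; cartesianProductWith; allFin)
open import Data.List.Properties using (map-tabulate)
open import Data.List.Membership.Propositional using (_∈_)
open import Data.List.Membership.Propositional.Properties
  using (∈-filter⁺; ∈-filter⁻; ∈-allFin; ∈-cartesianProductWith⁺)
open import Data.List.Membership.Propositional.Properties.WithK using (unique∧set⇒bag)
open import Data.List.Relation.Binary.BagAndSetEquality using (∼bag⇒↭)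
open import Data.List.Relation.Binary.Permutation.Propositional as ↭ using (_↭_)
open import Data.List.Relation.Binary.Permutation.Propositional.Properties using (↭-length)
open import Data.List.Relation.Binary.Pointwise using (Pointwise; []; _∷_)
open import Data.List.Relation.Unary.All using ([])
open import Data.List.Relation.Unary.AllPairs using ([]; _∷_)
open import Data.List.Relation.Unary.Any using (here; there)
open import Data.List.Relation.Unary.Unique.Propositional using (Unique)
import Data.List.Relation.Unary.Unique.Propositional.Properties as Unique
open import Data.Product using (∃; _×_; _,_; proj₁; proj₂)
open import Data.Unit using (⊤; tt)
open import Data.Vec using (Vec; []; _∷_; lookup)
open import Data.Vec.Functional using () renaming (_∷_ to _∷ᶠ_)
open import Data.Vec.Properties using (∷-injective)
open import Function using (_∘_)
open import Function.Bundles using (mk⇔; Equivalence)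
open import Relation.Binary.Definitions using (tri<; tri≈; tri>)
open import Relation.Binary.PropositionalEquality
open import Relation.Binary.Structures using (IsStrictTotalOrder)
open import Relation.Nullary
  using (¬_; Dec; yes; no; contradiction; ¬?; _×-dec_; _→-dec_; map′; decidable-stable)
open import Relation.Unary using (Decidable)

module ℕ-Product = CommutativeMonoidSum ℕ.*-1-commutativeMonoid

-- Arithmetic of the ordered field.

module Field (ℝ : RealField) where
  open Linear ℝ public

  commutativeRing : CommutativeRing _ _
  commutativeRing = record { isCommutativeRing = isCommutativeRing }

  open CommutativeRing commutativeRing public using
    ( +-assoc; +-comm; +-identityˡ; +-identityʳ; -‿inverseˡ; -‿inverseʳ
    ; *-assoc; *-comm; *-identityˡ; *-identityʳ; distribˡ; distribʳ; zeroˡ; zeroʳ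
    ; ring; +-commutativeSemigroup; *-commutativeSemigroup; commutativeSemiring)
  open RingProperties ring public using
    (+-cancelʳ; -‿distribˡ-*; -‿distribʳ-*; -1*x≈-x; -‿involutive)
  open CommutativeSemigroupProperties +-commutativeSemigroup public
    using () renaming (interchange to +-interchange; x∙yz≈y∙xz to x+[y+z]≡y+[x+z])
  open CommutativeSemigroupProperties *-commutativeSemigroup public
    using () renaming (x∙yz≈y∙xz to x*[y*z]≡y*[x*z]; interchange to *-interchange)
  module Solver = SemiringSolver commutativeSemiring
  open ≡-Reasoning

  infix 4 _≟_
  _≟_ : (x y : Carrier) → Dec (x ≡ y)
  _≟_ = IsStrictTotalOrder._≟_ isStrictTotalOrder

  module < = IsStrictTotalOrder isStrictTotalOrder

  -- Extended by inv 0# = 0#.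
  inv : Carrier → Carrier
  inv x with x ≟ 0#
  ... | yes _   = 0#
  ... | no  x≢0 = proj₁ (inverse x x≢0)

  *-inv : ∀ {x} → x ≢ 0# → x * inv x ≡ 1#
  *-inv {x} x≢0 with x ≟ 0#
  ... | yes x≡0 = contradiction x≡0 x≢0
  ... | no  x≢0 = proj₂ (inverse x x≢0)

  inv-unique : ∀ {x y z} → y * x ≡ 1# → z * x ≡ 1# → y ≡ z
  inv-unique {x} {y} {z} yx≡1 zx≡1 = begin
    y            ≡⟨ *-identityʳ y ⟨
    y * 1#       ≡⟨ cong (y *_) zx≡1 ⟨
    y * (z * x)  ≡⟨ x*[y*z]≡y*[x*z] y z x ⟩
    z * (y * x)  ≡⟨ cong (z *_) yx≡1 ⟩
    z * 1#       ≡⟨ *-identityʳ z ⟩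
    z            ∎

  0<1 : 0# < 1#
  0<1 with <.compare 0# 1#
  ... | tri< 0<1 _ _ = 0<1
  ... | tri≈ _ 0≡1 _ = contradiction 0≡1 0≢1
  ... | tri> _ _ 1<0 = contradiction (<.trans 1<0 0<1′) (<.irrefl refl)
    where
    0<-1 : 0# < - 1#
    0<-1 = subst₂ _<_ (-‿inverseʳ 1#) (+-identityˡ (- 1#)) (+-mono-< (- 1#) 1<0)

    0<1′ : 0# < 1#
    0<1′ = subst (0# <_)
      (trans (sym (-‿distribˡ-* 1# (- 1#))) (trans (cong -_ (*-identityˡ (- 1#))) (-‿involutive 1#)))
      (*-pos 0<-1 0<-1)

  -- An ordered field has characteristic zero; this permits division by the number of points of a
  -- flat.
  fromℕ-suc>0 : ∀ n → 0# < fromℕ (suc n)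
  fromℕ-suc>0 zero    = subst (0# <_) (sym (+-identityʳ 1#)) 0<1
  fromℕ-suc>0 (suc n) = <.trans (fromℕ-suc>0 n)
    (subst (_< fromℕ (suc (suc n))) (+-identityˡ _) (+-mono-< (fromℕ (suc n)) 0<1))

  fromℕ-suc≢0 : ∀ n → fromℕ (suc n) ≢ 0#
  fromℕ-suc≢0 n eq = <.irrefl (sym eq) (fromℕ-suc>0 n)

  fromℕ-+ : ∀ m n → fromℕ (m ℕ.+ n) ≡ fromℕ m + fromℕ n
  fromℕ-+ zero    n = sym (+-identityˡ _)
  fromℕ-+ (suc m) n = trans (cong (1# +_) (fromℕ-+ m n)) (sym (+-assoc 1# _ _))

  fromℕ-* : ∀ m n → fromℕ (m ℕ.* n) ≡ fromℕ m * fromℕ n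
  fromℕ-* zero    n = sym (zeroˡ _)
  fromℕ-* (suc m) n = begin
    fromℕ (n ℕ.+ m ℕ.* n)            ≡⟨ fromℕ-+ n (m ℕ.* n) ⟩
    fromℕ n + fromℕ (m ℕ.* n)        ≡⟨ cong₂ _+_ (sym (*-identityˡ _)) (fromℕ-* m n) ⟩
    1# * fromℕ n + fromℕ m * fromℕ n ≡⟨ distribʳ _ 1# (fromℕ m) ⟨
    (1# + fromℕ m) * fromℕ n         ∎

  -- Finite sums over lists.

  infix 5 Σᴸ
  Σᴸ : {A : Set} → List A → (A → Carrier) → Carrier
  Σᴸ xs f = sumL (map f xs)
  syntax Σᴸ xs (λ x → e) = Σ[ x ← xs ] e

  module _ {A : Set} where

    Σᴸ-cong : ∀ (xs : List A) {f g : A → Carrier} → (∀ x → f x ≡ g x) → Σᴸ xs f ≡ Σᴸ xs g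
    Σᴸ-cong []       f≗g = refl
    Σᴸ-cong (x ∷ xs) f≗g = cong₂ _+_ (f≗g x) (Σᴸ-cong xs f≗g)

    Σᴸ-zero : ∀ (xs : List A) → Σᴸ xs (λ _ → 0#) ≡ 0#
    Σᴸ-zero []       = refl
    Σᴸ-zero (x ∷ xs) = trans (+-identityˡ _) (Σᴸ-zero xs)

    Σᴸ-+ : ∀ (xs : List A) (f g : A → Carrier) → (Σ[ x ← xs ] (f x + g x)) ≡ Σᴸ xs f + Σᴸ xs g
    Σᴸ-+ []       f g = sym (+-identityˡ 0#)
    Σᴸ-+ (x ∷ xs) f g = trans (cong (f x + g x +_) (Σᴸ-+ xs f g)) (+-interchange _ _ _ _)

    Σᴸ-*ˡ : ∀ (xs : List A) c (f : A → Carrier) → (Σ[ x ← xs ] c * f x) ≡ c * Σᴸ xs f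
    Σᴸ-*ˡ []       c f = sym (zeroʳ c)
    Σᴸ-*ˡ (x ∷ xs) c f = trans (cong (c * f x +_) (Σᴸ-*ˡ xs c f)) (sym (distribˡ c _ _))

    Σᴸ-*ʳ : ∀ (xs : List A) (f : A → Carrier) c → (Σ[ x ← xs ] f x * c) ≡ Σᴸ xs f * c
    Σᴸ-*ʳ xs f c = trans (Σᴸ-cong xs (λ x → *-comm (f x) c)) (trans (Σᴸ-*ˡ xs c f) (*-comm c _))

    Σᴸ-++ : ∀ (xs ys : List A) (f : A → Carrier) → Σᴸ (xs ++ ys) f ≡ Σᴸ xs f + Σᴸ ys f
    Σᴸ-++ []       ys f = sym (+-identityˡ _)
    Σᴸ-++ (x ∷ xs) ys f = trans (cong (f x +_) (Σᴸ-++ xs ys f)) (sym (+-assoc _ _ _))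

    Σᴸ-↭ : ∀ {xs ys : List A} (f : A → Carrier) → xs ↭ ys → Σᴸ xs f ≡ Σᴸ ys f
    Σᴸ-↭ f ↭.refl           = refl
    Σᴸ-↭ f (↭.prep x p)     = cong (f x +_) (Σᴸ-↭ f p)
    Σᴸ-↭ f (↭.swap x y p)   =
      trans (cong (λ s → f x + (f y + s)) (Σᴸ-↭ f p)) (x+[y+z]≡y+[x+z] _ _ _)
    Σᴸ-↭ f (↭.trans p q)    = trans (Σᴸ-↭ f p) (Σᴸ-↭ f q)

    Σᴸ-const1 : ∀ (xs : List A) → (Σ[ _ ← xs ] 1#) ≡ fromℕ (length xs)
    Σᴸ-const1 []       = refl
    Σᴸ-const1 (x ∷ xs) = cong (1# +_) (Σᴸ-const1 xs)

  Σᴸ-map : ∀ {A B : Set} (g : A → B) xs (f : B → Carrier) → Σᴸ (map g xs) f ≡ Σᴸ xs (f ∘ g)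
  Σᴸ-map g []       f = refl
  Σᴸ-map g (x ∷ xs) f = cong (f (g x) +_) (Σᴸ-map g xs f)

  Σᴸ-swap : ∀ {A B : Set} (xs : List A) (ys : List B) (f : A → B → Carrier) →
            (Σ[ x ← xs ] Σ[ y ← ys ] f x y) ≡ (Σ[ y ← ys ] Σ[ x ← xs ] f x y)
  Σᴸ-swap []       ys f = sym (Σᴸ-zero ys)
  Σᴸ-swap (x ∷ xs) ys f = trans (cong (Σᴸ ys (f x) +_) (Σᴸ-swap xs ys f)) (sym (Σᴸ-+ ys _ _))

  Σᴸ-cartesianProductWith : ∀ {A B C : Set} (g : A → B → C) xs ys (f : C → Carrier) →
    Σᴸ (cartesianProductWith g xs ys) f ≡ (Σ[ x ← xs ] Σ[ y ← ys ] f (g x y))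
  Σᴸ-cartesianProductWith g []       ys f = refl
  Σᴸ-cartesianProductWith g (x ∷ xs) ys f = trans (Σᴸ-++ (map (g x) ys) _ f)
    (cong₂ _+_ (Σᴸ-map (g x) ys f) (Σᴸ-cartesianProductWith g xs ys f))

  Σᴸ-allFin : ∀ {k} (f : Fin k → Carrier) → Σᴸ (allFin k) f ≡ ∑ f
  Σᴸ-allFin {k} f = trans (cong sumL (map-tabulate {n = k} (λ i → i) f)) (sumL-tabulate f)
    where
    sumL-tabulate : ∀ {k} (f : Fin k → Carrier) → sumL (List.tabulate f) ≡ ∑ f
    sumL-tabulate {zero}  f = refl
    sumL-tabulate {suc k} f = cong (f zero +_) (sumL-tabulate (f ∘ suc))

  abstract
    -- Opaque, so that indicators of compound decisions stay folded and are handled only through the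
    -- laws that follow.
    𝟙 : {P : Set} → Dec P → Carrier
    𝟙 (yes _) = 1#
    𝟙 (no  _) = 0#

    𝟙-true : ∀ {P : Set} (P? : Dec P) → P → 𝟙 P? ≡ 1#
    𝟙-true (yes _) p = refl
    𝟙-true (no ¬p) p = contradiction p ¬p

    𝟙-false : ∀ {P : Set} (P? : Dec P) → ¬ P → 𝟙 P? ≡ 0#
    𝟙-false (yes p) ¬p = contradiction p ¬p
    𝟙-false (no _)  ¬p = refl

    𝟙-*-cong : ∀ {P : Set} (P? : Dec P) {x y : Carrier} → (P → x ≡ y) → 𝟙 P? * x ≡ 𝟙 P? * y
    𝟙-*-cong (yes p) x≡y = cong (1# *_) (x≡y p)
    𝟙-*-cong (no _)  x≡y = trans (zeroˡ _) (sym (zeroˡ _))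

    𝟙-true-* : ∀ {P : Set} (P? : Dec P) {x : Carrier} → P → 𝟙 P? * x ≡ x
    𝟙-true-* P? p = trans (cong (_* _) (𝟙-true P? p)) (*-identityˡ _)

    𝟙-false-* : ∀ {P : Set} (P? : Dec P) {x : Carrier} → ¬ P → 𝟙 P? * x ≡ 0#
    𝟙-false-* P? ¬p = trans (cong (_* _) (𝟙-false P? ¬p)) (zeroˡ _)

    𝟙-¬ : ∀ {P : Set} (P? : Dec P) → 𝟙 P? + 𝟙 (¬? P?) ≡ 1#
    𝟙-¬ (yes _) = +-identityʳ 1#
    𝟙-¬ (no _)  = +-identityˡ 1#

    𝟙-cong : ∀ {P Q : Set} (P? : Dec P) (Q? : Dec Q) → (P → Q) → (Q → P) → 𝟙 P? ≡ 𝟙 Q?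
    𝟙-cong (yes p) Q? P⇒Q Q⇒P = sym (𝟙-true Q? (P⇒Q p))
    𝟙-cong (no ¬p) Q? P⇒Q Q⇒P = sym (𝟙-false Q? (¬p ∘ Q⇒P))

    𝟙-× : ∀ {P Q : Set} (P? : Dec P) (Q? : Dec Q) → 𝟙 (P? ×-dec Q?) ≡ 𝟙 P? * 𝟙 Q?
    𝟙-× (yes p) (yes q) = sym (*-identityˡ 1#)
    𝟙-× (yes p) (no _)  = sym (zeroʳ 1#)
    𝟙-× (no _)  Q?      = sym (zeroˡ (𝟙 Q?))

  -- Sums over enumerated subsets and over tuples.

  Σᴸ-filter : ∀ {A : Set} {P : A → Set} (P? : Decidable P) xs (f : A → Carrier) →
              Σᴸ (filter P? xs) f ≡ (Σ[ x ← xs ] 𝟙 (P? x) * f x)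
  Σᴸ-filter P? []       f = refl
  Σᴸ-filter P? (x ∷ xs) f with P? x
  ... | yes p = cong₂ _+_ (sym (𝟙-true-* (yes p) p)) (Σᴸ-filter P? xs f)
  ... | no ¬p = trans (Σᴸ-filter P? xs f)
    (trans (sym (+-identityˡ _)) (cong (_+ (Σ[ x ← xs ] 𝟙 (P? x) * f x)) (sym (𝟙-false-* (no ¬p) ¬p))))

  -- Duplicate-free lists with the same members are equal as bags, hence permutations of each other.
  -- An arbitrary enumeration can thus be traded for a filter of one fixed list.
  Enumerates-↭ : ∀ {A : Set} {P : A → Set} {univ xs} → Unique univ → (∀ x → x ∈ univ) →
    (P? : Decidable P) → Enumerates P xs → xs ↭ filter P? univ
  Enumerates-↭ {univ = univ} univ! x∈univ P? (xs! , x∈xs⇔P) =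
    ∼bag⇒↭ (unique∧set⇒bag xs! (Unique.filter⁺ P? univ!) λ {x} → mk⇔
      (λ x∈xs → ∈-filter⁺ P? (x∈univ x) (Equivalence.to (x∈xs⇔P x) x∈xs))
      (λ x∈filter → Equivalence.from (x∈xs⇔P x) (proj₂ (∈-filter⁻ P? {xs = univ} x∈filter))))

  Σᴸ-Enumerates : ∀ {A : Set} {P : A → Set} {univ xs} → Unique univ → (∀ x → x ∈ univ) →
    (P? : Decidable P) → Enumerates P xs → (f : A → Carrier) →
    Σᴸ xs f ≡ (Σ[ x ← univ ] 𝟙 (P? x) * f x)
  Σᴸ-Enumerates {univ = univ} univ! x∈univ P? enum f =
    trans (Σᴸ-↭ f (Enumerates-↭ univ! x∈univ P? enum)) (Σᴸ-filter P? univ f)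

  Σᴸ-Enumerates-Fin : ∀ {T} {P : Fin T → Set} {xs} (P? : Decidable P) →
    Enumerates P xs → (f : Fin T → Carrier) → Σᴸ xs f ≡ (Σ[ x ← allFin T ] 𝟙 (P? x) * f x)
  Σᴸ-Enumerates-Fin {T} = Σᴸ-Enumerates (Unique.allFin⁺ T) ∈-allFin

  Σᴸ-single : ∀ {T} (m : Fin T) {P : Fin T → Set} (P? : Decidable P) → P m →
              (∀ x → P x → x ≡ m) → (Σ[ x ← allFin T ] 𝟙 (P? x)) ≡ 1#
  Σᴸ-single {T} m P? Pm unique = begin
    (Σ[ x ← allFin T ] 𝟙 (P? x))       ≡⟨ Σᴸ-cong (allFin T) (λ x → sym (*-identityʳ _)) ⟩
    (Σ[ x ← allFin T ] 𝟙 (P? x) * 1#)  ≡⟨ Σᴸ-Enumerates-Fin P? (([] ∷ []) , λ x → mk⇔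
        (λ { (here refl) → Pm }) (λ Px → here (unique x Px))) (λ _ → 1#) ⟨
    1# + 0#                            ≡⟨ +-identityʳ 1# ⟩
    1#                                 ∎

  tuples : ∀ T r → List (Vec (Fin T) r)
  tuples T zero    = [] ∷ []
  tuples T (suc r) = cartesianProductWith _∷_ (allFin T) (tuples T r)

  tuples-unique : ∀ T r → Unique (tuples T r)
  tuples-unique T zero    = [] ∷ []
  tuples-unique T (suc r) =
    Unique.cartesianProductWith⁺ _∷_ ∷-injective (Unique.allFin⁺ T) (tuples-unique T r)

  ∈-tuples : ∀ {T r} (W : Vec (Fin T) r) → W ∈ tuples T r
  ∈-tuples []      = here refl
  ∈-tuples (x ∷ W) = ∈-cartesianProductWith⁺ _∷_ (∈-allFin x) (∈-tuples W)

  Σᴸ-tuples-suc : ∀ T r (f : Vec (Fin T) (suc r) → Carrier) →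
    Σᴸ (tuples T (suc r)) f ≡ (Σ[ W ← tuples T r ] Σ[ x ← allFin T ] f (x ∷ W))
  Σᴸ-tuples-suc T r f =
    trans (Σᴸ-cartesianProductWith _∷_ (allFin T) (tuples T r) f) (Σᴸ-swap (allFin T) (tuples T r) _)

-- Matroids given by a closure operator on tuples.

record Matroid (T : ℕ) : Set₁ where
  infix 4 _⊢_ _⊢?_
  field
    _⊢_      : ∀ {r} → Vec (Fin T) r → Fin T → Set
    _⊢?_     : ∀ {r} (W : Vec (Fin T) r) → Decidable (W ⊢_)
    entry    : ∀ {r} (W : Vec (Fin T) r) m → W ⊢ lookup W m
    closed   : ∀ {r s} (W : Vec (Fin T) r) {V : Vec (Fin T) s} →
               (∀ m → V ⊢ lookup W m) → ∀ {j} → W ⊢ j → V ⊢ j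
    exchange : ∀ {r} {W : Vec (Fin T) r} {x y} → ¬ W ⊢ y → (x ∷ W) ⊢ y → (y ∷ W) ⊢ x
    loopless : ∀ {j} → ¬ [] ⊢ j

  infix 4 _⊑_
  -- There is no type of flats: a flat is represented by any tuple spanning it, and `⊑` in both
  -- directions says that two tuples represent the same flat.
  _⊑_ : ∀ {r s} → Vec (Fin T) r → Vec (Fin T) s → Set
  W ⊑ V = ∀ {j} → W ⊢ j → V ⊢ j

  head-⊢ : ∀ {r} x (W : Vec (Fin T) r) → (x ∷ W) ⊢ x
  head-⊢ x W = entry (x ∷ W) zero

  tail-⊑ : ∀ {r} x (W : Vec (Fin T) r) → W ⊑ (x ∷ W)
  tail-⊑ x W = closed W (λ m → entry (x ∷ W) (suc m))

  ∷-⊑ : ∀ {r s} {x} {W : Vec (Fin T) r} {V : Vec (Fin T) s} → V ⊢ x → W ⊑ V → (x ∷ W) ⊑ V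
  ∷-⊑ {x = x} {W} V⊢x W⊑V = closed (x ∷ W) λ { zero → V⊢x ; (suc m) → W⊑V (entry W m) }

  ∷-mono-⊑ : ∀ {r s} x {W : Vec (Fin T) r} {V : Vec (Fin T) s} → W ⊑ V → (x ∷ W) ⊑ (x ∷ V)
  ∷-mono-⊑ x {V = V} W⊑V = ∷-⊑ (head-⊢ x V) (tail-⊑ x V ∘ W⊑V)

  swap-⊑ : ∀ {r} x y (W : Vec (Fin T) r) → (x ∷ y ∷ W) ⊑ (y ∷ x ∷ W)
  swap-⊑ x y W = ∷-⊑ (tail-⊑ y (x ∷ W) (head-⊢ x W)) (∷-mono-⊑ y (tail-⊑ x W))

  -- Built up from the last entry, so that every suffix is an ordered basis of its own flat, as in
  -- the spans of last entries in the theorem.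
  Independent : ∀ {r} → Vec (Fin T) r → Set
  Independent []      = ⊤
  Independent (x ∷ W) = ¬ W ⊢ x × Independent W

  independent? : ∀ {r} → Decidable (Independent {r})
  independent? []      = yes tt
  independent? (x ∷ W) = ¬? (W ⊢? x) ×-dec independent? W

  LowerBound : ∀ {r} → Vec (Fin T) r → Fin T → Set
  LowerBound W x = ∀ j → W ⊢ j → toℕ x ℕ.≤ toℕ j

  lowerBound? : ∀ {r} (W : Vec (Fin T) r) → Decidable (LowerBound W)
  lowerBound? W x = Fin.all? (λ j → (W ⊢? j) →-dec (toℕ x ℕ.≤? toℕ j))

  minimum : ∀ {r} x (W : Vec (Fin T) r) → ∃ λ m → (x ∷ W) ⊢ m × LowerBound (x ∷ W) m
  -- The minimum is the smallest counterexample to the claim that no point lies in the flat, a claim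
  -- that `x` refutes.
  minimum x W with Fin.¬∀⟶∃¬-smallest T (λ j → ¬ (x ∷ W) ⊢ j) (λ j → ¬? ((x ∷ W) ⊢? j))
                     (λ none → none x (head-⊢ x W))
  ... | m , ¬¬m , below = m , decidable-stable ((x ∷ W) ⊢? m) ¬¬m , λ j W⊢j → ℕ.≮⇒≥ λ j<m →
    below (Fin.fromℕ< j<m)
      (subst ((x ∷ W) ⊢_) (Fin.toℕ-injective (sym (trans (Fin.toℕ-inject _) (Fin.toℕ-fromℕ< j<m)))) W⊢j)

  -- An independent set listed in increasing order contains no circuit stripped of its least element
  -- exactly when every suffix starts with the minimum of the flat it spans; the recursion uses the
  -- latter form.
  NoBrokenCircuit : ∀ {r} → Vec (Fin T) r → Set
  NoBrokenCircuit []      = ⊤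
  NoBrokenCircuit (x ∷ W) = (¬ W ⊢ x × LowerBound (x ∷ W) x) × NoBrokenCircuit W

  noBrokenCircuit? : ∀ {r} → Decidable (NoBrokenCircuit {r})
  noBrokenCircuit? []      = yes tt
  noBrokenCircuit? (x ∷ W) = (¬? (W ⊢? x) ×-dec lowerBound? (x ∷ W) x) ×-dec noBrokenCircuit? W

  NoBrokenCircuit⇒Independent : ∀ {r} (W : Vec (Fin T) r) → NoBrokenCircuit W → Independent W
  NoBrokenCircuit⇒Independent []      _                = tt
  NoBrokenCircuit⇒Independent (x ∷ W) ((W⊬x , _) , nbc) = W⊬x , NoBrokenCircuit⇒Independent W nbc

  count : ∀ {r} → Vec (Fin T) r → ℕ
  count W = length (filter (W ⊢?_) (allFin T))

  -- This is W[H], with the factor of the whole span first.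
  flagSize : ∀ {r} → Vec (Fin T) r → ℕ
  flagSize []      = 1
  flagSize (x ∷ W) = count (x ∷ W) ℕ.* flagSize W

-- Pairings with kernels on tuples, and the weights of ordered bases.

module FlagWeights (ℝ : RealField) {T : ℕ} (M : Matroid T) where
  open Field ℝ
  open Matroid M
  open ≡-Reasoning

  points : List (Fin T)
  points = allFin T

  infix 5 ⟨_∣_⟩
  abstract
    -- A linear functional of `φ` with kernel `κ`. The kernel is left general so that the same laws
    -- serve both `weight` and `nbc`.
    ⟨_∣_⟩ : ∀ {r} (κ φ : Vec (Fin T) r → Carrier) → Carrier
    ⟨_∣_⟩ {r} κ φ = Σ[ W ← tuples T r ] κ W * φ W

    ⟨∣⟩≡Σ : ∀ {r} (κ φ : Vec (Fin T) r → Carrier) → ⟨ κ ∣ φ ⟩ ≡ (Σ[ W ← tuples T r ] κ W * φ W)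
    ⟨∣⟩≡Σ κ φ = refl

    ⟨∣⟩-cong′ : ∀ {r} (κ : Vec (Fin T) r → Carrier) {φ ψ} → (∀ W → κ W * φ W ≡ κ W * ψ W) → ⟨ κ ∣ φ ⟩ ≡ ⟨ κ ∣ ψ ⟩
    ⟨∣⟩-cong′ {r} κ κφ≗κψ = Σᴸ-cong (tuples T r) κφ≗κψ

    ⟨∣⟩-cong : ∀ {r} (κ : Vec (Fin T) r → Carrier) {φ ψ} → (∀ W → φ W ≡ ψ W) → ⟨ κ ∣ φ ⟩ ≡ ⟨ κ ∣ ψ ⟩
    ⟨∣⟩-cong {r} κ φ≗ψ = Σᴸ-cong (tuples T r) (λ W → cong (κ W *_) (φ≗ψ W))

    ⟨∣⟩-+ : ∀ {r} (κ : Vec (Fin T) r → Carrier) φ ψ → ⟨ κ ∣ (λ W → φ W + ψ W) ⟩ ≡ ⟨ κ ∣ φ ⟩ + ⟨ κ ∣ ψ ⟩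
    ⟨∣⟩-+ {r} κ φ ψ = trans (Σᴸ-cong (tuples T r) (λ W → distribˡ (κ W) _ _)) (Σᴸ-+ (tuples T r) _ _)

    ⟨∣⟩-*ˡ : ∀ {r} (κ : Vec (Fin T) r → Carrier) c φ → ⟨ κ ∣ (λ W → c * φ W) ⟩ ≡ c * ⟨ κ ∣ φ ⟩
    ⟨∣⟩-*ˡ {r} κ c φ = trans (Σᴸ-cong (tuples T r) (λ W → x*[y*z]≡y*[x*z] (κ W) c (φ W)))
                       (Σᴸ-*ˡ (tuples T r) c _)

    ⟨∣⟩-Σ : ∀ {r} (κ : Vec (Fin T) r → Carrier) {A : Set} (xs : List A) (f : A → Vec (Fin T) r → Carrier) →
            ⟨ κ ∣ (λ W → Σ[ x ← xs ] f x W) ⟩ ≡ (Σ[ x ← xs ] ⟨ κ ∣ f x ⟩)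
    ⟨∣⟩-Σ {r} κ xs f = trans (Σᴸ-cong (tuples T r) (λ W → sym (Σᴸ-*ˡ xs (κ W) _))) (Σᴸ-swap (tuples T r) xs _)

    -- Splits off the first entry for a kernel that factors there, as `weight` and `nbc` do; the
    -- arguments by induction on the rank rest on it.
    ⟨∣⟩-suc : ∀ {r} (κ : Vec (Fin T) r → Carrier) (κ′ φ : Vec (Fin T) (suc r) → Carrier)
              (a : Fin T → Vec (Fin T) r → Carrier) →
              (∀ x W → κ′ (x ∷ W) ≡ a x W * κ W) →
              ⟨ κ′ ∣ φ ⟩ ≡ ⟨ κ ∣ (λ W → Σ[ x ← points ] a x W * φ (x ∷ W)) ⟩
    ⟨∣⟩-suc {r} κ κ′ φ a κ′-∷ = begin
      ⟨ κ′ ∣ φ ⟩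
        ≡⟨ Σᴸ-tuples-suc T r _ ⟩
      (Σ[ W ← tuples T r ] Σ[ x ← points ] κ′ (x ∷ W) * φ (x ∷ W))
        ≡⟨ Σᴸ-cong (tuples T r) (λ W → Σᴸ-cong points λ x →
             trans (cong (_* φ (x ∷ W)) (trans (κ′-∷ x W) (*-comm _ _))) (*-assoc _ _ _)) ⟩
      (Σ[ W ← tuples T r ] Σ[ x ← points ] κ W * (a x W * φ (x ∷ W)))
        ≡⟨ Σᴸ-cong (tuples T r) (λ W → Σᴸ-*ˡ points (κ W) _) ⟩
      ⟨ κ ∣ (λ W → Σ[ x ← points ] a x W * φ (x ∷ W)) ⟩ ∎

  card : ∀ {r} → Vec (Fin T) r → Carrier
  card W = fromℕ (count W)

  card≡Σ : ∀ {r} (W : Vec (Fin T) r) → card W ≡ (Σ[ j ← points ] 𝟙 (W ⊢? j))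
  card≡Σ W = begin
    fromℕ (count W)                              ≡⟨ Σᴸ-const1 (filter (W ⊢?_) points) ⟨
    (Σ[ _ ← filter (W ⊢?_) points ] 1#)          ≡⟨ Σᴸ-filter (W ⊢?_) points (λ _ → 1#) ⟩
    (Σ[ j ← points ] 𝟙 (W ⊢? j) * 1#)            ≡⟨ Σᴸ-cong points (λ j → *-identityʳ _) ⟩
    (Σ[ j ← points ] 𝟙 (W ⊢? j))                 ∎

  card≢0 : ∀ {r} x (W : Vec (Fin T) r) → card (x ∷ W) ≢ 0#
  card≢0 x W with filter ((x ∷ W) ⊢?_) points | ∈-filter⁺ ((x ∷ W) ⊢?_) (∈-allFin x) (head-⊢ x W)
  ... | _ ∷ ys | _ = fromℕ-suc≢0 (length ys)

  -- The indicator extends 1/W[H] by zero to dependent tuples, so that sums can run over all of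
  -- `tuples T r`.
  weight : ∀ {r} → Vec (Fin T) r → Carrier
  weight []      = 1#
  weight (x ∷ W) = (𝟙 (¬? (W ⊢? x)) * inv (card (x ∷ W))) * weight W

  weight-dependent : ∀ {r} (W : Vec (Fin T) r) → ¬ Independent W → weight W ≡ 0#
  weight-dependent []      dep = contradiction tt dep
  weight-dependent (x ∷ W) dep with W ⊢? x
  ... | yes W⊢x = trans (cong (_* weight W) (𝟙-false-* (¬? (yes W⊢x)) (λ W⊬x → W⊬x W⊢x))) (zeroˡ _)
  ... | no  W⊬x = trans (cong (𝟙 (¬? (no W⊬x)) * inv (card (x ∷ W)) *_) (weight-dependent W (λ ind → dep (W⊬x , ind))))
                        (zeroʳ _)

  weight-independent : ∀ {r} (W : Vec (Fin T) r) → Independent W → weight W * fromℕ (flagSize W) ≡ 1#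
  weight-independent []      _           = trans (*-identityˡ _) (+-identityʳ 1#)
  weight-independent (x ∷ W) (W⊬x , ind) = begin
    (𝟙 (¬? (W ⊢? x)) * inv (card (x ∷ W))) * weight W * fromℕ (flagSize (x ∷ W))
      ≡⟨ cong₂ (λ i s → i * weight W * s) (𝟙-true-* (¬? (W ⊢? x)) W⊬x) (fromℕ-* (count (x ∷ W)) (flagSize W)) ⟩
    inv (card (x ∷ W)) * weight W * (card (x ∷ W) * fromℕ (flagSize W))
      ≡⟨ *-interchange _ _ _ _ ⟩
    inv (card (x ∷ W)) * card (x ∷ W) * (weight W * fromℕ (flagSize W))
      ≡⟨ cong₂ _*_ (trans (*-comm _ _) (*-inv (card≢0 x W))) (weight-independent W ind) ⟩
    1# * 1#
      ≡⟨ *-identityˡ 1# ⟩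
    1# ∎

  -- Functions of flats and Weisner's identity.

  E : ∀ r → (Vec (Fin T) r → Carrier) → Carrier
  E r φ = ⟨ weight ∣ φ ⟩

  -- Says that `φ` is a function of the flat alone. Pairing such a `φ` with `weight` is a sum over
  -- flats, as all ordered bases of one flat share one value.
  Invariant : ∀ {r} → (Vec (Fin T) r → Carrier) → Set
  Invariant φ = ∀ {W V} → W ⊑ V → V ⊑ W → φ W ≡ φ V

  Invariant-* : ∀ {r} {φ ψ : Vec (Fin T) r → Carrier} → Invariant φ → Invariant ψ →
                Invariant (λ W → φ W * ψ W)
  Invariant-* φ-inv ψ-inv W⊑V V⊑W = cong₂ _*_ (φ-inv W⊑V V⊑W) (ψ-inv W⊑V V⊑W)

  Invariant-Σ : ∀ {r} {A : Set} (xs : List A) {f : A → Vec (Fin T) r → Carrier} →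
                (∀ x → Invariant (f x)) → Invariant (λ W → Σ[ x ← xs ] f x W)
  Invariant-Σ xs f-inv W⊑V V⊑W = Σᴸ-cong xs (λ x → f-inv x W⊑V V⊑W)

  Invariant-∷ : ∀ {r} x {φ : Vec (Fin T) (suc r) → Carrier} → Invariant φ → Invariant (λ W → φ (x ∷ W))
  Invariant-∷ x φ-inv W⊑V V⊑W = φ-inv (∷-mono-⊑ x W⊑V) (∷-mono-⊑ x V⊑W)

  Invariant-⊢ : ∀ {r} j → Invariant {r} (λ W → 𝟙 (W ⊢? j))
  Invariant-⊢ j W⊑V V⊑W = 𝟙-cong _ _ W⊑V V⊑W

  Invariant-⊬ : ∀ {r} j → Invariant {r} (λ W → 𝟙 (¬? (W ⊢? j)))
  Invariant-⊬ j W⊑V V⊑W = 𝟙-cong _ _ (λ W⊬j V⊢j → W⊬j (V⊑W V⊢j)) (λ V⊬j W⊢j → V⊬j (W⊑V W⊢j))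

  Invariant-card : ∀ {r} → Invariant {r} card
  Invariant-card {_} {W} {V} W⊑V V⊑W =
    trans (card≡Σ W) (trans (Invariant-Σ points Invariant-⊢ {W} {V} W⊑V V⊑W) (sym (card≡Σ V)))

  Invariant-lowerBound : ∀ {r} x → Invariant {r} (λ W → 𝟙 (lowerBound? W x))
  Invariant-lowerBound x W⊑V V⊑W = 𝟙-cong _ _ (λ lb j → lb j ∘ V⊑W) (λ lb j → lb j ∘ W⊑V)

  E-suc : ∀ r φ → E (suc r) φ ≡
    E r (λ W → Σ[ x ← points ] (𝟙 (¬? (W ⊢? x)) * inv (card (x ∷ W))) * φ (x ∷ W))
  E-suc r φ = ⟨∣⟩-suc weight weight φ (λ x W → 𝟙 (¬? (W ⊢? x)) * inv (card (x ∷ W))) (λ _ _ → refl)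

  -- Weisner's identity, summed over flats with the coefficient φ; a flat of rank r occurs in E as its
  -- ordered bases, whose weights add up to the absolute Möbius value of the flat.
  weisner : ∀ r e {φ : Vec (Fin T) (suc r) → Carrier} → Invariant φ →
            E r (λ W → 𝟙 (¬? (W ⊢? e)) * φ (e ∷ W)) ≡ E (suc r) (λ W → 𝟙 (W ⊢? e) * φ W)

  module _ {r} (Φ : Vec (Fin T) (suc r) → Carrier) where

    -- For W spanning a flat K of rank r, crossing a b collects a ∨ K over the K that contain b but not a;
    -- joining a b collects a ∨ K over the K whose cover a ∨ K contains b.
    crossing joining : Fin T → Fin T → Vec (Fin T) r → Carrier
    crossing a b W = 𝟙 (¬? (W ⊢? a)) * (𝟙 (W ⊢? b) * Φ (a ∷ W))
    joining  a b W = 𝟙 (¬? (W ⊢? a)) * (𝟙 ((a ∷ W) ⊢? b) * Φ (a ∷ W))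

  -- `weisner` one rank below, with `e` equal to `b`, trades the flats through `b` for flats `W` not
  -- containing `b`. The remaining condition, `b` outside `W` and `a` outside `b ∷ W`, is symmetric
  -- by exchange. The mutual recursion is well founded: `weisner r` calls this lemma at `r`, and
  -- this lemma at `suc r` calls `weisner r`.
  crossing-comm : ∀ r {Φ : Vec (Fin T) (suc r) → Carrier} → Invariant Φ → ∀ a b →
                  E r (crossing Φ a b) ≡ E r (crossing Φ b a)
  crossing-comm zero {Φ} Φ-inv a b = ⟨∣⟩-cong weight λ { [] → trans (vanish a b) (sym (vanish b a)) }
    where
    vanish : ∀ a b → crossing Φ a b [] ≡ 0#
    vanish a b = trans (cong (𝟙 (¬? ([] ⊢? a)) *_) (𝟙-false-* ([] ⊢? b) loopless)) (zeroʳ _)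
  crossing-comm (suc r) {Φ} Φ-inv a b = begin
    E (suc r) (crossing Φ a b)  ≡⟨ lower a b ⟩
    E r (twice a b)             ≡⟨ ⟨∣⟩-cong weight twice-comm ⟩
    E r (twice b a)             ≡⟨ lower b a ⟨
    E (suc r) (crossing Φ b a)  ∎
    where
    twice : Fin T → Fin T → Vec (Fin T) r → Carrier
    twice a b W = 𝟙 (¬? (W ⊢? b)) * (𝟙 (¬? ((b ∷ W) ⊢? a)) * Φ (a ∷ b ∷ W))

    lower : ∀ a b → E (suc r) (crossing Φ a b) ≡ E r (twice a b)
    lower a b = begin
      E (suc r) (crossing Φ a b)
        ≡⟨ ⟨∣⟩-cong weight (λ W → x*[y*z]≡y*[x*z] (𝟙 (¬? (W ⊢? a))) (𝟙 (W ⊢? b)) (Φ (a ∷ W))) ⟩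
      E (suc r) (λ W → 𝟙 (W ⊢? b) * (𝟙 (¬? (W ⊢? a)) * Φ (a ∷ W)))
        ≡⟨ weisner r b {λ W → 𝟙 (¬? (W ⊢? a)) * Φ (a ∷ W)}
             (Invariant-* {φ = λ W → 𝟙 (¬? (W ⊢? a))} {λ W → Φ (a ∷ W)}
               (Invariant-⊬ a) (Invariant-∷ a {Φ} Φ-inv)) ⟨
      E r (twice a b) ∎

    separated : ∀ a b {W : Vec (Fin T) r} → ¬ W ⊢ b × ¬ (b ∷ W) ⊢ a → ¬ W ⊢ a × ¬ (a ∷ W) ⊢ b
    separated a b {W} (W⊬b , bW⊬a) = bW⊬a ∘ tail-⊑ b W , bW⊬a ∘ exchange W⊬b

    twice-comm : ∀ W → twice a b W ≡ twice b a W
    twice-comm W = begin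
      twice a b W
        ≡⟨ *-assoc _ _ _ ⟨
      𝟙 (¬? (W ⊢? b)) * 𝟙 (¬? ((b ∷ W) ⊢? a)) * Φ (a ∷ b ∷ W)
        ≡⟨ cong₂ _*_
             (trans (sym (𝟙-× (¬? (W ⊢? b)) (¬? ((b ∷ W) ⊢? a))))
               (trans (𝟙-cong _ _ (separated a b) (separated b a))
                 (𝟙-× (¬? (W ⊢? a)) (¬? ((a ∷ W) ⊢? b)))))
             (Φ-inv (swap-⊑ a b W) (swap-⊑ b a W)) ⟩
      𝟙 (¬? (W ⊢? a)) * 𝟙 (¬? ((a ∷ W) ⊢? b)) * Φ (b ∷ a ∷ W)
        ≡⟨ *-assoc _ _ _ ⟩
      twice b a W ∎

  -- By cases on which of the two points lie in the flat of `W`. If both do, all four terms vanish.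
  -- If exactly one does, one joining term equals the crossing term with the same arguments and the
  -- other two terms vanish. If neither does, the crossing terms vanish and exchange equates the
  -- joining terms.
  joining+crossing : ∀ {r} {Φ : Vec (Fin T) (suc r) → Carrier} → Invariant Φ → ∀ a b W →
    joining Φ a b W + crossing Φ b a W ≡ joining Φ b a W + crossing Φ a b W
  joining+crossing {Φ = Φ} Φ-inv a b W = go (W ⊢? a) (W ⊢? b)
    where
    joining-in : ∀ {a b} → W ⊢ a → joining Φ a b W ≡ 0#
    joining-in {a} W⊢a = 𝟙-false-* (¬? (W ⊢? a)) (λ W⊬a → W⊬a W⊢a)

    crossing-in : ∀ {a b} → W ⊢ a → crossing Φ a b W ≡ 0#
    crossing-in {a} W⊢a = 𝟙-false-* (¬? (W ⊢? a)) (λ W⊬a → W⊬a W⊢a)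

    crossing-out : ∀ {a b} → ¬ W ⊢ b → crossing Φ a b W ≡ 0#
    crossing-out {a} {b} W⊬b = trans (cong (𝟙 (¬? (W ⊢? a)) *_) (𝟙-false-* (W ⊢? b) W⊬b)) (zeroʳ _)

    joining≡crossing : ∀ {a b} → W ⊢ b → joining Φ a b W ≡ crossing Φ a b W
    joining≡crossing {a} {b} W⊢b = cong (λ i → 𝟙 (¬? (W ⊢? a)) * (i * Φ (a ∷ W)))
      (trans (𝟙-true ((a ∷ W) ⊢? b) (tail-⊑ a W W⊢b)) (sym (𝟙-true (W ⊢? b) W⊢b)))

    joining-comm : ¬ W ⊢ a → ¬ W ⊢ b → joining Φ a b W ≡ joining Φ b a W
    joining-comm W⊬a W⊬b = begin
      joining Φ a b W
        ≡⟨ 𝟙-true-* (¬? (W ⊢? a)) W⊬a ⟩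
      𝟙 ((a ∷ W) ⊢? b) * Φ (a ∷ W)
        ≡⟨ 𝟙-*-cong ((a ∷ W) ⊢? b) (λ aW⊢b → Φ-inv
             (∷-⊑ (exchange W⊬b aW⊢b) (tail-⊑ b W)) (∷-⊑ aW⊢b (tail-⊑ a W))) ⟩
      𝟙 ((a ∷ W) ⊢? b) * Φ (b ∷ W)
        ≡⟨ cong (_* Φ (b ∷ W)) (𝟙-cong _ _ (exchange W⊬b) (exchange W⊬a)) ⟩
      𝟙 ((b ∷ W) ⊢? a) * Φ (b ∷ W)
        ≡⟨ 𝟙-true-* (¬? (W ⊢? b)) W⊬b ⟨
      joining Φ b a W ∎

    go : Dec (W ⊢ a) → Dec (W ⊢ b) →
         joining Φ a b W + crossing Φ b a W ≡ joining Φ b a W + crossing Φ a b W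
    go (yes W⊢a) (yes W⊢b) = cong₂ _+_ (trans (joining-in W⊢a) (sym (joining-in W⊢b)))
                                       (trans (crossing-in W⊢b) (sym (crossing-in W⊢a)))
    go (yes W⊢a) (no W⊬b)  = trans
      (cong₂ _+_ (trans (joining-in W⊢a) (sym (crossing-in W⊢a))) (sym (joining≡crossing W⊢a)))
      (+-comm _ _)
    go (no W⊬a)  (yes W⊢b) = trans
      (cong₂ _+_ (joining≡crossing W⊢b) (trans (crossing-in W⊢b) (sym (joining-in W⊢b))))
      (+-comm _ _)
    go (no W⊬a)  (no W⊬b)  = cong₂ _+_ (joining-comm W⊬a W⊬b)
                                       (trans (crossing-out W⊬a) (sym (crossing-out W⊬b)))

  weisner r e {φ} φ-inv = begin
    E r (λ W → 𝟙 (¬? (W ⊢? e)) * φ (e ∷ W))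
      ≡⟨ ⟨∣⟩-cong weight spread ⟩
    E r (λ W → Σ[ x ← points ] joining Φ e x W)
      ≡⟨ +-cancelʳ _ _ _ balance ⟩
    E r (λ W → Σ[ x ← points ] joining Φ x e W)
      ≡⟨ ⟨∣⟩-cong weight (λ W → Σᴸ-cong points (λ x → gather W x)) ⟩
    E r (λ W → Σ[ x ← points ] (𝟙 (¬? (W ⊢? x)) * inv (card (x ∷ W))) * (𝟙 ((x ∷ W) ⊢? e) * φ (x ∷ W)))
      ≡⟨ E-suc r _ ⟨
    E (suc r) (λ W → 𝟙 (W ⊢? e) * φ W) ∎
    where
    -- Absorbs into the coefficient the factor 1/|F| contributed by the first entry; that factor
    -- depends only on the flat.
    Φ : Vec (Fin T) (suc r) → Carrier
    Φ W = inv (card W) * φ W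

    Φ-inv : Invariant Φ
    Φ-inv = Invariant-* {φ = λ W → inv (card W)} {φ} (λ p q → cong inv (Invariant-card p q)) φ-inv

    -- The coefficient at `e ∷ W` is divided evenly among the points `x` of that flat, in
    -- `card (e ∷ W)` shares of `Φ (e ∷ W)`.
    spread : ∀ W → 𝟙 (¬? (W ⊢? e)) * φ (e ∷ W) ≡ (Σ[ x ← points ] joining Φ e x W)
    spread W = sym (begin
      (Σ[ x ← points ] joining Φ e x W)
        ≡⟨ Σᴸ-*ˡ points (𝟙 (¬? (W ⊢? e))) _ ⟩
      𝟙 (¬? (W ⊢? e)) * (Σ[ x ← points ] 𝟙 ((e ∷ W) ⊢? x) * Φ (e ∷ W))
        ≡⟨ cong (𝟙 (¬? (W ⊢? e)) *_) (begin
             (Σ[ x ← points ] 𝟙 ((e ∷ W) ⊢? x) * Φ (e ∷ W))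
               ≡⟨ Σᴸ-*ʳ points _ (Φ (e ∷ W)) ⟩
             (Σ[ x ← points ] 𝟙 ((e ∷ W) ⊢? x)) * Φ (e ∷ W)
               ≡⟨ cong (_* Φ (e ∷ W)) (card≡Σ (e ∷ W)) ⟨
             card (e ∷ W) * (inv (card (e ∷ W)) * φ (e ∷ W))
               ≡⟨ *-assoc _ _ _ ⟨
             card (e ∷ W) * inv (card (e ∷ W)) * φ (e ∷ W)
               ≡⟨ cong (_* φ (e ∷ W)) (*-inv (card≢0 e W)) ⟩
             1# * φ (e ∷ W)
               ≡⟨ *-identityˡ _ ⟩
             φ (e ∷ W) ∎) ⟩
      𝟙 (¬? (W ⊢? e)) * φ (e ∷ W) ∎)

    gather : ∀ W x → joining Φ x e W ≡
             (𝟙 (¬? (W ⊢? x)) * inv (card (x ∷ W))) * (𝟙 ((x ∷ W) ⊢? e) * φ (x ∷ W))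
    gather W x = solve 4 (λ a b c d → a :* (c :* (b :* d)) := (a :* b) :* (c :* d)) refl _ _ _ _
      where open Solver

    -- With a crossing sum added, `joining+crossing` interchanges `e` and `x` for each `W`, and
    -- `crossing-comm` then restores the crossing sum, so that it can be cancelled.
    balance : E r (λ W → Σ[ x ← points ] joining Φ e x W) + (Σ[ x ← points ] E r (crossing Φ x e)) ≡
              E r (λ W → Σ[ x ← points ] joining Φ x e W) + (Σ[ x ← points ] E r (crossing Φ x e))
    balance = begin
      E r (λ W → Σ[ x ← points ] joining Φ e x W) + (Σ[ x ← points ] E r (crossing Φ x e))
        ≡⟨ combine (joining Φ e) (λ x → crossing Φ x e) ⟩
      (Σ[ x ← points ] E r (λ W → joining Φ e x W + crossing Φ x e W))
        ≡⟨ Σᴸ-cong points (λ x → ⟨∣⟩-cong weight (joining+crossing Φ-inv e x)) ⟩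
      (Σ[ x ← points ] E r (λ W → joining Φ x e W + crossing Φ e x W))
        ≡⟨ combine (λ x → joining Φ x e) (crossing Φ e) ⟨
      E r (λ W → Σ[ x ← points ] joining Φ x e W) + (Σ[ x ← points ] E r (crossing Φ e x))
        ≡⟨ cong₂ _+_ refl (Σᴸ-cong points (crossing-comm r Φ-inv e)) ⟩
      E r (λ W → Σ[ x ← points ] joining Φ x e W) + (Σ[ x ← points ] E r (crossing Φ x e)) ∎
      where
      combine : ∀ (f g : Fin T → Vec (Fin T) r → Carrier) →
        E r (λ W → Σ[ x ← points ] f x W) + (Σ[ x ← points ] E r (g x)) ≡
        (Σ[ x ← points ] E r (λ W → f x W + g x W))
      combine f g = begin
        E r (λ W → Σ[ x ← points ] f x W) + (Σ[ x ← points ] E r (g x))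
          ≡⟨ cong (_+ _) (⟨∣⟩-Σ weight points f) ⟩
        (Σ[ x ← points ] E r (f x)) + (Σ[ x ← points ] E r (g x))
          ≡⟨ Σᴸ-+ points _ _ ⟨
        (Σ[ x ← points ] (E r (f x) + E r (g x)))
          ≡⟨ Σᴸ-cong points (λ x → ⟨∣⟩-+ weight (f x) (g x)) ⟨
        (Σ[ x ← points ] E r (λ W → f x W + g x W)) ∎

  -- No-broken-circuit bases are counted by the same totals.

  nbc : ∀ {r} → Vec (Fin T) r → Carrier
  nbc W = 𝟙 (noBrokenCircuit? W)

  minimum-unique : ∀ {r} x (W : Vec (Fin T) r) →
    (Σ[ y ← points ] 𝟙 ((x ∷ W) ⊢? y) * 𝟙 (lowerBound? (x ∷ W) y)) ≡ 1#
  minimum-unique x W with m , ⊢m , m-lb ← minimum x W =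
    trans (Σᴸ-cong points (λ y → sym (𝟙-× ((x ∷ W) ⊢? y) (lowerBound? (x ∷ W) y))))
      (Σᴸ-single m (λ y → ((x ∷ W) ⊢? y) ×-dec lowerBound? (x ∷ W) y) (⊢m , m-lb)
        (λ y (⊢y , y-lb) → Fin.toℕ-injective (ℕ.≤-antisym (y-lb m ⊢m) (m-lb y ⊢y))))

  -- Induction on the rank. Once the first entry is split off, the inner sum over it is again a
  -- function of the flat of the tail, so the induction hypothesis replaces `nbc` by `weight` there.
  nbc≡E : ∀ r {φ : Vec (Fin T) r → Carrier} → Invariant φ → ⟨ nbc ∣ φ ⟩ ≡ E r φ
  nbc≡E zero {φ} φ-inv = trans (⟨∣⟩≡Σ nbc φ)
    (trans (cong (λ i → i * φ [] + 0#) (𝟙-true (noBrokenCircuit? []) tt)) (sym (⟨∣⟩≡Σ weight φ)))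
  nbc≡E (suc r) {φ} φ-inv = begin
    ⟨ nbc ∣ φ ⟩
      ≡⟨ ⟨∣⟩-suc nbc nbc φ _ (λ x W → 𝟙-× (¬? (W ⊢? x) ×-dec lowerBound? (x ∷ W) x) (noBrokenCircuit? W)) ⟩
    ⟨ nbc ∣ (λ W → Σ[ x ← points ] 𝟙 (¬? (W ⊢? x) ×-dec lowerBound? (x ∷ W) x) * φ (x ∷ W)) ⟩
      ≡⟨ ⟨∣⟩-cong nbc (λ W → Σᴸ-cong points (λ x →
           trans (cong (_* φ (x ∷ W)) (𝟙-× (¬? (W ⊢? x)) (lowerBound? (x ∷ W) x))) (*-assoc _ _ _))) ⟩
    ⟨ nbc ∣ (λ W → Σ[ x ← points ] 𝟙 (¬? (W ⊢? x)) * ψ x (x ∷ W)) ⟩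
      ≡⟨ nbc≡E r (Invariant-Σ points {λ x W → 𝟙 (¬? (W ⊢? x)) * ψ x (x ∷ W)} (λ x →
           Invariant-* {φ = λ W → 𝟙 (¬? (W ⊢? x))} {λ W → ψ x (x ∷ W)}
             (Invariant-⊬ x) (Invariant-∷ x {ψ x} (ψ-inv x)))) ⟩
    E r (λ W → Σ[ x ← points ] 𝟙 (¬? (W ⊢? x)) * ψ x (x ∷ W))
      ≡⟨ ⟨∣⟩-Σ weight points _ ⟩
    (Σ[ x ← points ] E r (λ W → 𝟙 (¬? (W ⊢? x)) * ψ x (x ∷ W)))
      -- `weisner` takes one `e` for all flats, so it is applied for each `x` separately; `ψ x`
      -- keeps only the flats with lower bound `x`.
      ≡⟨ Σᴸ-cong points (λ x → weisner r x (ψ-inv x)) ⟩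
    (Σ[ x ← points ] E (suc r) (λ W → 𝟙 (W ⊢? x) * ψ x W))
      ≡⟨ ⟨∣⟩-Σ weight points _ ⟨
    E (suc r) (λ W → Σ[ x ← points ] 𝟙 (W ⊢? x) * ψ x W)
      -- Every flat spanned by a nonempty tuple has exactly one minimum, so the indicators sum to 1.
      ≡⟨ ⟨∣⟩-cong weight (λ { W@(x ∷ W′) →
           trans (Σᴸ-cong points (λ y → sym (*-assoc (𝟙 (W ⊢? y)) (𝟙 (lowerBound? W y)) (φ W))))
             (trans (Σᴸ-*ʳ points _ (φ W))
               (trans (cong (_* φ W) (minimum-unique x W′)) (*-identityˡ (φ W)))) }) ⟩
    E (suc r) φ ∎
    where
    ψ : Fin T → Vec (Fin T) (suc r) → Carrier
    ψ x W = 𝟙 (lowerBound? W x) * φ W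

    ψ-inv : ∀ x → Invariant (ψ x)
    ψ-inv x = Invariant-* {φ = λ W → 𝟙 (lowerBound? W x)} {φ} (Invariant-lowerBound x) φ-inv

  -- The top rank and the average over the points.

  module _ {n} (spanning : ∀ (W : Vec (Fin T) (suc n)) → Independent W → ∀ j → W ⊢ j) where

    -- Weisner's identity with coefficient 1: in the top rank every independent tuple already spans
    -- `j`, and dependent tuples have weight zero.
    E-avoiding : ∀ j → E n (λ W → 𝟙 (¬? (W ⊢? j))) ≡ E (suc n) (λ _ → 1#)
    E-avoiding j = begin
      E n (λ W → 𝟙 (¬? (W ⊢? j)))            ≡⟨ ⟨∣⟩-cong weight (λ W → *-identityʳ _) ⟨
      E n (λ W → 𝟙 (¬? (W ⊢? j)) * 1#)       ≡⟨ weisner n j (λ _ _ → refl) ⟩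
      E (suc n) (λ W → 𝟙 (W ⊢? j) * 1#)      ≡⟨ ⟨∣⟩-cong′ weight (λ W → contains W (independent? W)) ⟩
      E (suc n) (λ _ → 1#)                   ∎
      where
      contains : ∀ W → Dec (Independent W) → weight W * (𝟙 (W ⊢? j) * 1#) ≡ weight W * 1#
      contains W (yes ind) = cong (weight W *_) (𝟙-true-* (W ⊢? j) (spanning W ind j))
      contains W (no dep)  = trans (cong (_* (𝟙 (W ⊢? j) * 1#)) (weight-dependent W dep))
        (trans (zeroˡ _) (sym (trans (cong (_* 1#) (weight-dependent W dep)) (zeroˡ 1#))))

    nbc-avoiding≡E-average : ∀ (p : Fin T → Carrier) → ∑ p ≡ 1# → ∀ j →
      ⟨ nbc ∣ (λ W → 𝟙 (¬? (W ⊢? j))) ⟩ ≡ E n (λ W → 1# - (Σ[ i ← points ] 𝟙 (W ⊢? i) * p i))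
    nbc-avoiding≡E-average p ∑p≡1 j = begin
      ⟨ nbc ∣ (λ W → 𝟙 (¬? (W ⊢? j))) ⟩
        ≡⟨ nbc≡E n (Invariant-⊬ j) ⟩
      E n (λ W → 𝟙 (¬? (W ⊢? j)))
        ≡⟨ E-avoiding j ⟩
      E (suc n) (λ _ → 1#)
        ≡⟨ *-identityˡ _ ⟨
      1# * E (suc n) (λ _ → 1#)
        -- The factor 1 becomes the total mass of `p`; each share `p i` is then paired with the
        -- hyperplanes avoiding its own point `i`.
        ≡⟨ cong (_* _) Σp≡1 ⟨
      Σᴸ points p * E (suc n) (λ _ → 1#)
        ≡⟨ Σᴸ-*ʳ points p _ ⟨
      (Σ[ i ← points ] p i * E (suc n) (λ _ → 1#))
        ≡⟨ Σᴸ-cong points (λ i → cong (p i *_) (E-avoiding i)) ⟨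
      (Σ[ i ← points ] p i * E n (λ W → 𝟙 (¬? (W ⊢? i))))
        ≡⟨ Σᴸ-cong points (λ i → ⟨∣⟩-*ˡ weight (p i) _) ⟨
      (Σ[ i ← points ] E n (λ W → p i * 𝟙 (¬? (W ⊢? i))))
        ≡⟨ ⟨∣⟩-Σ weight points _ ⟨
      E n (λ W → Σ[ i ← points ] p i * 𝟙 (¬? (W ⊢? i)))
        ≡⟨ ⟨∣⟩-cong weight complement ⟩
      E n (λ W → 1# - (Σ[ i ← points ] 𝟙 (W ⊢? i) * p i)) ∎
      where
      Σp≡1 : Σᴸ points p ≡ 1#
      Σp≡1 = trans (Σᴸ-allFin p) ∑p≡1

      complement : ∀ W → (Σ[ i ← points ] p i * 𝟙 (¬? (W ⊢? i))) ≡
                         1# - (Σ[ i ← points ] 𝟙 (W ⊢? i) * p i)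
      complement W = begin
        A                ≡⟨ +-identityʳ A ⟨
        A + 0#           ≡⟨ cong (A +_) (-‿inverseʳ B) ⟨
        A + (B - B)      ≡⟨ +-assoc A B (- B) ⟨
        (A + B) - B      ≡⟨ cong (_- B) (begin
          A + B                      ≡⟨ Σᴸ-+ points _ _ ⟨
          (Σ[ i ← points ] (p i * 𝟙 (¬? (W ⊢? i)) + 𝟙 (W ⊢? i) * p i))
            ≡⟨ Σᴸ-cong points (λ i → begin
                 p i * 𝟙 (¬? (W ⊢? i)) + 𝟙 (W ⊢? i) * p i
                   ≡⟨ cong₂ _+_ refl (*-comm _ _) ⟩
                 p i * 𝟙 (¬? (W ⊢? i)) + p i * 𝟙 (W ⊢? i)
                   ≡⟨ distribˡ (p i) _ _ ⟨
                 p i * (𝟙 (¬? (W ⊢? i)) + 𝟙 (W ⊢? i))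
                   ≡⟨ cong (p i *_) (trans (+-comm _ _) (𝟙-¬ (W ⊢? i))) ⟩
                 p i * 1#
                   ≡⟨ *-identityʳ (p i) ⟩
                 p i ∎) ⟩
          Σᴸ points p                ≡⟨ Σp≡1 ⟩
          1#                         ∎) ⟩
        1# - B           ∎
        where
        A B : Carrier
        A = Σ[ i ← points ] p i * 𝟙 (¬? (W ⊢? i))
        B = Σ[ i ← points ] 𝟙 (W ⊢? i) * p i

-- Linear algebra in coordinates: spans, exchange and elimination.

module Vectors (ℝ : RealField) where
  open Field ℝ
  open ≡-Reasoning

  combination : ∀ {d k} → (Fin k → Carrier) → (Fin k → Fin d → Carrier) → Fin d → Carrier
  combination c v a = ∑ (λ i → c i * v i a)

  -- Unlike `InSpan`, free of a support condition and stated for any dimension `d`, because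
  -- elimination lowers the dimension. As a record it determines `v` and `x` for inference.
  record Span {d k} (v : Fin k → Fin d → Carrier) (x : Fin d → Carrier) : Set where
    constructor span
    field
      coefficients : Fin k → Carrier
      expansion    : ∀ a → x a ≡ combination coefficients v a

  Free : ∀ {d k} → (Fin k → Fin d → Carrier) → Set
  Free {k = k} v = ∀ (c : Fin k → Carrier) → (∀ a → combination c v a ≡ 0#) → ∀ i → c i ≡ 0#

  module _ {d : ℕ} where

    Span-resp : ∀ {k} {v : Fin k → Fin d → Carrier} {x y} → (∀ a → y a ≡ x a) → Span v x → Span v y
    Span-resp y≗x (span c x≗) = span c λ a → trans (y≗x a) (x≗ a)

    Span-zero : ∀ {k} (v : Fin k → Fin d → Carrier) → Span v (λ _ → 0#)
    Span-zero v = span (λ _ → 0#) λ a → sym (∑-zero v a)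
      where
      ∑-zero : ∀ {k} (v : Fin k → Fin d → Carrier) a → combination (λ _ → 0#) v a ≡ 0#
      ∑-zero {zero}  v a = refl
      ∑-zero {suc k} v a = trans (cong₂ _+_ (zeroˡ (v zero a)) (∑-zero (v ∘ suc) a)) (+-identityˡ 0#)

    combination-linear : ∀ {k} (c c₀ : Carrier) (v : Fin k → Fin d → Carrier) (b b₀ : Fin k → Carrier) a →
      c * combination b v a + c₀ * combination b₀ v a ≡ combination (λ i → c * b i + c₀ * b₀ i) v a
    combination-linear {zero} c c₀ v b b₀ a = trans (cong₂ _+_ (zeroʳ c) (zeroʳ c₀)) (+-identityˡ 0#)
    combination-linear {suc k} c c₀ v b b₀ a = trans
      (solve 7 (λ c c₀ b b₀ v s s₀ →
        c :* (b :* v :+ s) :+ c₀ :* (b₀ :* v :+ s₀) := (c :* b :+ c₀ :* b₀) :* v :+ (c :* s :+ c₀ :* s₀))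
        refl c c₀ (b zero) (b₀ zero) (v zero a) _ _)
      (cong ((c * b zero + c₀ * b₀ zero) * v zero a +_) (combination-linear c c₀ (v ∘ suc) (b ∘ suc) (b₀ ∘ suc) a))
      where open Solver

    Span-linear : ∀ {k} {v : Fin k → Fin d → Carrier} c c₀ {x y} → Span v x → Span v y →
                  Span v (λ a → c * x a + c₀ * y a)
    Span-linear {v = v} c c₀ (span b x≗) (span b₀ y≗) = span (λ i → c * b i + c₀ * b₀ i) λ a →
      trans (cong₂ (λ x y → c * x + c₀ * y) (x≗ a) (y≗ a)) (combination-linear c c₀ v b b₀ a)

    Span-∷ : ∀ {k} (v : Fin (suc k) → Fin d → Carrier) {x y} c → Span (v ∘ suc) y →
             (∀ a → x a ≡ c * v zero a + y a) → Span v x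
    Span-∷ v c (span b y≗) x≗ = span (c ∷ᶠ b) λ a → trans (x≗ a) (cong₂ _+_ refl (y≗ a))

    Span-tail : ∀ {k} (v : Fin (suc k) → Fin d → Carrier) {x} → Span (v ∘ suc) x → Span v x
    Span-tail v {x} s = Span-∷ v 0# s λ a →
      sym (trans (cong (_+ x a) (zeroˡ (v zero a))) (+-identityˡ (x a)))

    Span-member : ∀ {k} (v : Fin k → Fin d → Carrier) i → Span v (v i)
    Span-member v zero    = Span-∷ v 1# (Span-zero (v ∘ suc)) λ a →
      sym (trans (+-identityʳ _) (*-identityˡ (v zero a)))
    Span-member v (suc i) = Span-tail v (Span-member (v ∘ suc) i)

    Span-trans : ∀ {k l} (u : Fin k → Fin d → Carrier) {v : Fin l → Fin d → Carrier} {x} →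
                 (∀ i → Span v (u i)) → Span u x → Span v x
    Span-trans u {v} u∈v (span c x≗) = Span-resp x≗ (go u u∈v c)
      where
      go : ∀ {k} (u : Fin k → Fin d → Carrier) → (∀ i → Span v (u i)) → ∀ c → Span v (combination c u)
      go {zero}  u u∈v c = Span-zero v
      go {suc k} u u∈v c = Span-resp (λ a → cong₂ _+_ refl (sym (*-identityˡ _)))
        (Span-linear (c zero) 1# (u∈v zero) (go (u ∘ suc) (u∈v ∘ suc) (c ∘ suc)))

    Span-zero-head : ∀ {k} (v : Fin (suc k) → Fin d → Carrier) {x} → (∀ a → v zero a ≡ 0#) →
                     Span v x → Span (v ∘ suc) x
    Span-zero-head v v₀≗0 (span c x≗) = span (c ∘ suc) λ a → trans (x≗ a)
      (trans (cong₂ _+_ (trans (cong (c zero *_) (v₀≗0 a)) (zeroʳ (c zero))) refl) (+-identityˡ _))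

    solve-for-head : ∀ {c x y z} → c ≢ 0# → z ≡ c * x + y → x ≡ inv c * z + (- inv c) * y
    solve-for-head {c} {x} {y} {z} c≢0 z≡ = sym (begin
      inv c * z + (- inv c) * y
        ≡⟨ cong (λ z → inv c * z + (- inv c) * y) z≡ ⟩
      inv c * (c * x + y) + (- inv c) * y
        ≡⟨ solve 5 (λ i m c x y → i :* (c :* x :+ y) :+ m :* y := (c :* i) :* x :+ (i :+ m) :* y)
             refl (inv c) (- inv c) c x y ⟩
      (c * inv c) * x + (inv c + (- inv c)) * y
        ≡⟨ cong₂ (λ p q → p * x + q * y) (*-inv c≢0) (-‿inverseʳ (inv c)) ⟩
      1# * x + 0# * y
        ≡⟨ cong₂ _+_ (*-identityˡ x) (zeroˡ y) ⟩
      x + 0#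
        ≡⟨ +-identityʳ x ⟩
      x ∎)
      where open Solver

    Span-scale : ∀ {k} {v : Fin k → Fin d → Carrier} c {x} → Span v x → Span v (λ a → c * x a)
    Span-scale {v = v} c x∈ = Span-resp
      (λ a → sym (trans (cong₂ _+_ refl (zeroˡ 0#)) (+-identityʳ _)))
      (Span-linear c 0# x∈ (Span-zero v))

    -- The head occurs in `y` with nonzero coefficient, since otherwise the tail would span `y`;
    -- dividing by that coefficient expresses the head through `y` and the tail.
    Span-exchange : ∀ {k} (u : Fin (suc k) → Fin d → Carrier) {y} →
      ¬ Span (u ∘ suc) y → Span u y →
      ∃ λ c → ∃ λ z → Span (u ∘ suc) z × (∀ a → u zero a ≡ c * y a + z a)
    Span-exchange u y∉ (span c y≗) with c zero ≟ 0#
    ... | yes c≡0 = contradiction (span (c ∘ suc) λ a → trans (y≗ a)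
      (trans (cong₂ _+_ (trans (cong (_* u zero a) c≡0) (zeroˡ _)) refl) (+-identityˡ _))) y∉
    ... | no  c≢0 = inv (c zero) , _ ,
      Span-scale (- inv (c zero)) (span (c ∘ suc) λ _ → refl) , (λ a → solve-for-head c≢0 (y≗ a))

    -- Elimination with the pivot v₀ a, written without subtraction so that its linearity is a semiring identity.
    reduce : (Fin d → Carrier) → Fin d → (Fin d → Carrier) → Fin d → Carrier
    reduce v₀ a y b = y b + (y a * inv (v₀ a)) * (- v₀ b)

    module _ (v₀ : Fin d → Carrier) (a : Fin d) where

      reduce-combination : ∀ {k} (c : Fin k → Carrier) v b →
        reduce v₀ a (combination c v) b ≡ combination c (λ i → reduce v₀ a (v i)) b
      reduce-combination {zero}  c v b =
        trans (+-identityˡ _) (trans (cong (_* (- v₀ b)) (zeroˡ (inv (v₀ a)))) (zeroˡ _))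
      reduce-combination {suc k} c v b = trans
        (solve 7 (λ c p q i z s t →
          (c :* p :+ s) :+ ((c :* q :+ t) :* i) :* z := c :* (p :+ (q :* i) :* z) :+ (s :+ (t :* i) :* z))
          refl (c zero) (v zero b) (v zero a) (inv (v₀ a)) (- v₀ b) _ _)
        (cong (c zero * reduce v₀ a (v zero) b +_) (reduce-combination (c ∘ suc) (v ∘ suc) b))
        where open Solver

      reduce-cong : ∀ {x y} → (∀ b → x b ≡ y b) → ∀ b → reduce v₀ a x b ≡ reduce v₀ a y b
      reduce-cong x≗y b = cong₂ (λ p q → p + (q * inv (v₀ a)) * (- v₀ b)) (x≗y b) (x≗y a)

      reduce-pivot : v₀ a ≢ 0# → ∀ b → reduce v₀ a v₀ b ≡ 0#
      reduce-pivot v₀a≢0 b = trans (cong (v₀ b +_) (trans (cong (_* (- v₀ b)) (*-inv v₀a≢0)) (*-identityˡ _)))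
                                   (-‿inverseʳ (v₀ b))

      reduce-clears : v₀ a ≢ 0# → ∀ y → reduce v₀ a y a ≡ 0#
      reduce-clears v₀a≢0 y = begin
        y a + (y a * inv (v₀ a)) * (- v₀ a)  ≡⟨ cong (y a +_) (-‿distribʳ-* _ (v₀ a)) ⟨
        y a + - (y a * inv (v₀ a) * v₀ a)    ≡⟨ cong (λ z → y a + - z) (trans (*-assoc _ _ _)
          (trans (cong (y a *_) (trans (*-comm _ _) (*-inv v₀a≢0))) (*-identityʳ (y a)))) ⟩
        y a + - y a                          ≡⟨ -‿inverseʳ (y a) ⟩
        0#                                   ∎

      restore : ∀ y b → y b ≡ (y a * inv (v₀ a)) * v₀ b + reduce v₀ a y b
      restore y b = sym (begin
        μ * v₀ b + (y b + μ * (- v₀ b))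
          ≡⟨ solve 4 (λ m z n y → m :* z :+ (y :+ m :* n) := y :+ m :* (z :+ n)) refl μ (v₀ b) (- v₀ b) (y b) ⟩
        y b + μ * (v₀ b + (- v₀ b))
          ≡⟨ cong (λ z → y b + μ * z) (-‿inverseʳ (v₀ b)) ⟩
        y b + μ * 0#
          ≡⟨ trans (cong (y b +_) (zeroʳ μ)) (+-identityʳ (y b)) ⟩
        y b ∎)
        where
        open Solver
        μ : Carrier
        μ = y a * inv (v₀ a)

    Span-reduce⁺ : ∀ {k} (v : Fin (suc k) → Fin d → Carrier) {x a} → v zero a ≢ 0# → Span v x →
      Span (λ i → reduce (v zero) a (v (suc i))) (reduce (v zero) a x)
    Span-reduce⁺ v {a = a} v₀a≢0 (span c x≗) =
      Span-zero-head (λ i → reduce (v zero) a (v i)) (reduce-pivot (v zero) a v₀a≢0)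
        (span c λ b → trans (reduce-cong (v zero) a x≗ b) (reduce-combination (v zero) a c v b))

    Span-reduce⁻ : ∀ {k} (v : Fin (suc k) → Fin d → Carrier) {x a} →
      Span (λ i → reduce (v zero) a (v (suc i))) (reduce (v zero) a x) → Span v x
    Span-reduce⁻ v {x} {a} s = Span-resp
      (λ b → trans (restore (v zero) a x b) (cong₂ _+_ refl (sym (*-identityˡ _))))
      (Span-linear (x a * inv (v zero a)) 1# (Span-member v zero)
        (Span-trans (λ i → reduce (v zero) a (v (suc i))) reduced∈v s))
      where
      reduced∈v : ∀ i → Span v (reduce (v zero) a (v (suc i)))
      reduced∈v i = Span-resp
        (λ b → cong₂ _+_ (sym (*-identityˡ _))
          (trans (sym (-‿distribʳ-* _ (v zero b))) (-‿distribˡ-* _ (v zero b))))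
        (Span-linear 1# (- (v (suc i) a * inv (v zero a))) (Span-member v (suc i)) (Span-member v zero))

    -- Gaussian elimination, recursing on the number of vectors; equality of scalars is decidable
    -- because the order is total.
    span? : ∀ {k} (v : Fin k → Fin d → Carrier) x → Dec (Span v x)
    span? {zero}  v x = map′ (span (λ ())) Span.expansion (Fin.all? (λ a → x a ≟ 0#))
    span? {suc k} v x with Fin.all? (λ a → v zero a ≟ 0#)
    ... | yes v₀≗0 = map′ (Span-tail v) (Span-zero-head v v₀≗0) (span? (v ∘ suc) x)
    ... | no  v₀≢0 with a , v₀a≢0 ← Fin.¬∀⟶∃¬ d _ (λ a → v zero a ≟ 0#) v₀≢0 =
      map′ (Span-reduce⁻ v) (Span-reduce⁺ v v₀a≢0)
        (span? (λ i → reduce (v zero) a (v (suc i))) (reduce (v zero) a x))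

    -- Linear independence and the dimension bound.

    Free-tail : ∀ {k} (v : Fin (suc k) → Fin d → Carrier) → Free v → Free (v ∘ suc)
    Free-tail v free c c≗0 i = free (0# ∷ᶠ c) (λ a →
      trans (cong₂ _+_ (zeroˡ (v zero a)) (c≗0 a)) (+-identityˡ 0#)) (suc i)

    Free-head : ∀ {k} (v : Fin (suc k) → Fin d → Carrier) → Free v → ¬ Span (v ∘ suc) (v zero)
    Free-head v free (span c v₀≗) = 0≢1 (begin
      0#          ≡⟨ -‿inverseʳ 1# ⟨
      -- An expansion of the head through the tail is a relation with coefficient -1 at the head,
      -- which freeness forces to be zero.
      1# + - 1#   ≡⟨ cong (1# +_) (free ((- 1#) ∷ᶠ c) (λ a → begin
        (- 1#) * v zero a + combination c (v ∘ suc) a  ≡⟨ cong ((- 1#) * v zero a +_) (v₀≗ a) ⟨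
        (- 1#) * v zero a + v zero a                   ≡⟨ cong (_+ v zero a) (-1*x≈-x (v zero a)) ⟩
        (- v zero a) + v zero a                        ≡⟨ -‿inverseˡ (v zero a) ⟩
        0#                                             ∎) zero) ⟩
      1# + 0#     ≡⟨ +-identityʳ 1# ⟩
      1#          ∎)

    Free-∷ : ∀ {k} (v : Fin (suc k) → Fin d → Carrier) →
             ¬ Span (v ∘ suc) (v zero) → Free (v ∘ suc) → Free v
    Free-∷ v v₀∉ free c c≗0 with c zero ≟ 0#
    ... | no c≢0 = contradiction
      (Span-resp (λ a → trans (solve-for-head c≢0 (sym (c≗0 a)))
          (trans (cong₂ _+_ (zeroʳ (inv (c zero))) refl) (+-identityˡ _)))
        (Span-scale (- inv (c zero)) (span (c ∘ suc) λ _ → refl)))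
      v₀∉
    ... | yes c≡0 = λ { zero → c≡0 ; (suc i) → free (c ∘ suc) (λ a → trans (sym (trans
      (cong₂ _+_ (trans (cong (_* v zero a) c≡0) (zeroˡ _)) refl) (+-identityˡ _))) (c≗0 a)) i }

  -- One elimination step removes the head and its pivot coordinate `a`. Deleting the coordinate
  -- loses no information, because every reduced vector vanishes there, so the smaller family is
  -- still free.
  Free-bound : ∀ {d k} (v : Fin k → Fin d → Carrier) → Free v → k ℕ.≤ d
  Free-bound {k = zero} v free = ℕ.z≤n
  Free-bound {d} {suc k} v free
    with Fin.¬∀⟶∃¬ d _ (λ a → v zero a ≟ 0#) (λ v₀≗0 → Free-head v free (Span-resp v₀≗0 (Span-zero (v ∘ suc))))
  Free-bound {suc d} {suc k} v free | a , v₀a≢0 = ℕ.s≤s (Free-bound minor minor-free)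
    where
    minor : Fin k → Fin d → Carrier
    minor i b = reduce (v zero) a (v (suc i)) (Fin.punchIn a b)

    minor-free : Free minor
    minor-free c c≗0 i = free (μ ∷ᶠ c) (λ b → trans
      (cong (_+ y b) (trans (sym (-‿distribˡ-* _ (v zero b))) (-‿distribʳ-* _ (v zero b))))
      (trans (+-comm _ (y b)) (reduced-y≗0 b))) (suc i)
      where
      y : Fin (suc d) → Carrier
      y = combination c (v ∘ suc)

      -- The coefficient of the head that lifts a relation among the reduced vectors to one among
      -- the original vectors.
      μ : Carrier
      μ = - (y a * inv (v zero a))

      reduced-y≗0 : ∀ b → reduce (v zero) a y b ≡ 0#
      reduced-y≗0 b with a Fin.≟ b
      ... | yes refl = reduce-clears (v zero) a v₀a≢0 y
      ... | no  a≢b  = trans (reduce-combination (v zero) a c (v ∘ suc) b)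
        (subst (λ b → combination c (λ i → reduce (v zero) a (v (suc i))) b ≡ 0#)
          (Fin.punchIn-punchOut a≢b) (c≗0 (Fin.punchOut a≢b)))

-- The matroid of a point configuration.

module Configuration (ℝ : RealField) {n T : ℕ} (w : Fin T → Linear.Vecℝ ℝ n)
  (w≢0 : ∀ i → ¬ Linear.IsZeroVec ℝ (w i)) where
  open Field ℝ
  open Vectors ℝ

  family : ∀ {r} → Vec (Fin T) r → Fin r → Vecℝ n
  family W m = w (lookup W m)

  matroid : Matroid T
  matroid = record
    { _⊢_      = λ W j → Span (family W) (w j)
    ; _⊢?_     = λ W j → span? (family W) (w j)
    ; entry    = λ W m → Span-member (family W) m
    ; closed   = λ W W∈V → Span-trans (family W) W∈V
    ; exchange = λ {_} {W} {x} {y} W⊬y xW⊢y →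
        let c , z , z∈ , x≗ = Span-exchange (family (x ∷ W)) W⊬y xW⊢y
        in Span-∷ (family (y ∷ W)) c z∈ x≗
    ; loopless = λ {j} → λ { (span c w≗) → w≢0 j w≗ }
    }

  open Matroid matroid public
  open FlagWeights ℝ matroid public

  Independent⇒Free : ∀ {r} (W : Vec (Fin T) r) → Independent W → Free (family W)
  Independent⇒Free []      _           = λ c _ ()
  Independent⇒Free (x ∷ W) (W⊬x , ind) = Free-∷ (family (x ∷ W)) W⊬x (Independent⇒Free W ind)

  Free⇒Independent : ∀ {r} (W : Vec (Fin T) r) → Free (family W) → Independent W
  Free⇒Independent []      _    = tt
  Free⇒Independent (x ∷ W) free =
    Free-head (family (x ∷ W)) free , Free⇒Independent W (Free-tail (family (x ∷ W)) free)

  -- A point outside the span would extend `W` to n+2 independent vectors in dimension n+1.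
  independent-spanning : ∀ (W : Vec (Fin T) (suc n)) → Independent W → ∀ j → W ⊢ j
  independent-spanning W ind j = decidable-stable (W ⊢? j) λ W⊬j →
    ℕ.<-irrefl refl (Free-bound (family (j ∷ W)) (Independent⇒Free (j ∷ W) (W⊬j , ind)))

  lookup-injective : ∀ {r} (W : Vec (Fin T) r) → Independent W → ∀ l m → lookup W l ≡ lookup W m → l ≡ m
  lookup-injective (x ∷ W) _           zero    zero    _  = refl
  lookup-injective (x ∷ W) (W⊬x , _)   zero    (suc m) eq =
    contradiction (subst (W ⊢_) (sym eq) (entry W m)) W⊬x
  lookup-injective (x ∷ W) (W⊬x , _)   (suc l) zero    eq =
    contradiction (subst (W ⊢_) eq (entry W l)) W⊬x
  lookup-injective (x ∷ W) (_   , ind) (suc l) (suc m) eq = cong suc (lookup-injective W ind l m eq)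

  InHxn≠0⇒Independent : ∀ {W : Vec (Fin T) n} → InHxn≠0 w W → Independent W
  InHxn≠0⇒Independent {W} (_ , free) = Free⇒Independent W free

  Independent⇒InHxn≠0 : ∀ {W : Vec (Fin T) n} → Independent W → InHxn≠0 w W
  Independent⇒InHxn≠0 {W} ind = lookup-injective W ind , Independent⇒Free W ind

  -- Suffix spans and the η condition.

  InSuffixSpan : ∀ {r} → Vec (Fin T) r → ℕ → Fin T → Set
  InSuffixSpan W l j = InSpanOf (family W) (λ m → l ℕ.≤ toℕ m) (w j)

  whole⇒⊢ : ∀ {r} (W : Vec (Fin T) r) {j} → InSuffixSpan W 0 j → W ⊢ j
  whole⇒⊢ W (c , _ , w≗) = span c w≗

  ⊢⇒whole : ∀ {r} (W : Vec (Fin T) r) {j} → W ⊢ j → InSuffixSpan W 0 j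
  ⊢⇒whole W (span c w≗) = c , (λ i i≱0 → contradiction ℕ.z≤n i≱0) , w≗

  suffix-tail⁺ : ∀ {r} x (W : Vec (Fin T) r) {l j} → InSuffixSpan W l j → InSuffixSpan (x ∷ W) (suc l) j
  suffix-tail⁺ x W (c , support , w≗) = 0# ∷ᶠ c ,
    (λ { zero _ → refl ; (suc i) i≱l → support i (i≱l ∘ ℕ.s≤s) }) ,
    λ a → trans (w≗ a) (sym (trans (cong₂ _+_ (zeroˡ (w x a)) refl) (+-identityˡ _)))

  suffix-tail⁻ : ∀ {r} x (W : Vec (Fin T) r) {l j} → InSuffixSpan (x ∷ W) (suc l) j → InSuffixSpan W l j
  suffix-tail⁻ x W (c , support , w≗) = c ∘ suc , (λ i i≱l → support (suc i) (i≱l ∘ ℕ.s≤s⁻¹)) ,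
    λ a → trans (w≗ a)
      (trans (cong₂ _+_ (trans (cong (_* w x a) (support zero λ ())) (zeroˡ (w x a))) refl) (+-identityˡ _))

  suffix-entry : ∀ {r} (W : Vec (Fin T) r) (l m : Fin r) → toℕ l ℕ.≤ toℕ m → InSuffixSpan W (toℕ l) (lookup W m)
  suffix-entry (x ∷ W) zero    m       _         = ⊢⇒whole (x ∷ W) (entry (x ∷ W) m)
  suffix-entry (x ∷ W) (suc l) (suc m) (ℕ.s≤s l≤m) = suffix-tail⁺ x W (suffix-entry W l m l≤m)

  SuffixMinimal : ∀ {r} → Vec (Fin T) r → Set
  SuffixMinimal W = ∀ l j → InSuffixSpan W (toℕ l) j → toℕ (lookup W l) ℕ.≤ toℕ j

  NoBrokenCircuit⇒SuffixMinimal : ∀ {r} (W : Vec (Fin T) r) → NoBrokenCircuit W → SuffixMinimal W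
  NoBrokenCircuit⇒SuffixMinimal (x ∷ W) ((_ , x-lb) , _) zero    j s = x-lb j (whole⇒⊢ (x ∷ W) s)
  NoBrokenCircuit⇒SuffixMinimal (x ∷ W) (_ , nbc-W)      (suc l) j s =
    NoBrokenCircuit⇒SuffixMinimal W nbc-W l j (suffix-tail⁻ x W s)

  SuffixMinimal⇒NoBrokenCircuit : ∀ {r} (W : Vec (Fin T) r) → Independent W → SuffixMinimal W → NoBrokenCircuit W
  SuffixMinimal⇒NoBrokenCircuit []      _           _   = tt
  SuffixMinimal⇒NoBrokenCircuit (x ∷ W) (W⊬x , ind) min =
    (W⊬x , λ j xW⊢j → min zero j (⊢⇒whole (x ∷ W) xW⊢j)) ,
    SuffixMinimal⇒NoBrokenCircuit W ind (λ l j s → min (suc l) j (suffix-tail⁺ x W s))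

  -- The first entry is the minimum of the whole span, so an index of at least 1 there keeps the
  -- point of index 0 outside.
  SuffixMinimal⇒avoids : ∀ {r} (W : Vec (Fin T) r) → SuffixMinimal W → (∀ l → 1 ℕ.≤ toℕ (lookup W l)) →
                         ∀ j → toℕ j ≡ 0 → ¬ W ⊢ j
  SuffixMinimal⇒avoids []      _   _    j _   = loopless
  SuffixMinimal⇒avoids (x ∷ W) min 1≤ j j≡0 xW⊢j =
    contradiction (ℕ.≤-trans (1≤ zero) (subst (toℕ x ℕ.≤_) j≡0 (min zero j (⊢⇒whole (x ∷ W) xW⊢j)))) λ ()

  eta⇒ : ∀ {j} → toℕ j ≡ 0 → ∀ {W : Vec (Fin T) n} →
         EtaCondition w W × InHxn≠0 w W → NoBrokenCircuit W × ¬ W ⊢ j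
  eta⇒ {j} j≡0 {W} ((1≤ , _ , min) , inH) =
    SuffixMinimal⇒NoBrokenCircuit W (InHxn≠0⇒Independent inH) min , SuffixMinimal⇒avoids W min 1≤ j j≡0

  eta⇐ : ∀ {j} → toℕ j ≡ 0 → ∀ {W : Vec (Fin T) n} →
         NoBrokenCircuit W × ¬ W ⊢ j → EtaCondition w W × InHxn≠0 w W
  eta⇐ {j} j≡0 {W} (nbc-W , W⊬j) = (positive , increasing , min) , Independent⇒InHxn≠0 ind
    where
    ind : Independent W
    ind = NoBrokenCircuit⇒Independent W nbc-W

    min : SuffixMinimal W
    min = NoBrokenCircuit⇒SuffixMinimal W nbc-W

    positive : ∀ l → 1 ℕ.≤ toℕ (lookup W l)
    positive l = ℕ.n≢0⇒n>0 λ l≡0 →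
      W⊬j (subst (W ⊢_) (Fin.toℕ-injective (trans l≡0 (sym j≡0))) (entry W l))

    increasing : ∀ l m → toℕ l ℕ.< toℕ m → toℕ (lookup W l) ℕ.< toℕ (lookup W m)
    -- The later entry lies in the suffix span whose minimum is the entry at `l`; independence
    -- excludes equality.
    increasing l m l<m = ℕ.≤∧≢⇒< (min l (lookup W m) (suffix-entry W l m (ℕ.<⇒≤ l<m)))
      λ eq → ℕ.<⇒≢ l<m (cong toℕ (lookup-injective W ind l m (Fin.toℕ-injective eq)))

  -- Both sides of the formula as pairings.

  Enumerates-resp : ∀ {A : Set} {P Q : A → Set} {xs} → (∀ {x} → P x → Q x) → (∀ {x} → Q x → P x) →
                    Enumerates P xs → Enumerates Q xs
  Enumerates-resp P⇒Q Q⇒P (xs! , x∈xs⇔P) = xs! , λ x →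
    mk⇔ (P⇒Q ∘ Equivalence.to (x∈xs⇔P x)) (Equivalence.from (x∈xs⇔P x) ∘ Q⇒P)

  ∏-suffix-cards : ∀ {r} (W : Vec (Fin T) r) (q : Fin r → ℕ) →
                   (∀ l → HasCard (InSuffixSpan W (toℕ l)) (q l)) → ∏ℕ q ≡ flagSize W
  ∏-suffix-cards []      q q-card = refl
  ∏-suffix-cards (x ∷ W) q q-card = cong₂ ℕ._*_ (q₀≡count (q-card zero))
    (∏-suffix-cards W (q ∘ suc) λ l → let xs , enum , eq = q-card (suc l) in
      xs , Enumerates-resp (suffix-tail⁻ x W) (suffix-tail⁺ x W) enum , eq)
    where
    q₀≡count : HasCard (InSuffixSpan (x ∷ W) 0) (q zero) → q zero ≡ count (x ∷ W)
    q₀≡count (xs , enum , eq) = trans (sym eq) (↭-length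
      (Enumerates-↭ (Unique.allFin⁺ T) ∈-allFin ((x ∷ W) ⊢?_) (Enumerates-resp (whole⇒⊢ (x ∷ W)) (⊢⇒whole (x ∷ W)) enum)))

  ∏ℕ-opposite : ∀ {r} (q : Fin r → ℕ) → ∏ℕ q ≡ ∏ℕ (q ∘ opposite)
  ∏ℕ-opposite q = trans (∏ℕ≡product q)
    (trans (ℕ-Product.sum-permute q Permutation.reverse) (sym (∏ℕ≡product (q ∘ opposite))))
    where
    ∏ℕ≡product : ∀ {r} (q : Fin r → ℕ) → ∏ℕ q ≡ ℕ-Product.sum q
    ∏ℕ≡product {zero}  q = refl
    ∏ℕ≡product {suc r} q = cong (q zero ℕ.*_) (∏ℕ≡product (q ∘ suc))

  ∏q≡flagSize : ∀ (W : Vec (Fin T) n) (q : Fin n → ℕ) → (∀ l → Is-q w W l (q l)) → ∏ℕ q ≡ flagSize W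
  ∏q≡flagSize W q is-q = trans (∏ℕ-opposite q) (∏-suffix-cards W (q ∘ opposite) λ l →
    -- `Is-q` numbers suffixes by length, `∏-suffix-cards` by starting index;
    -- `n ∸ suc (toℕ (opposite l))` equals `toℕ l`.
    subst (λ i → HasCard (InSuffixSpan W i) (q (opposite l)))
      (trans (sym (Fin.opposite-prop (opposite l))) (cong toℕ (Fin.opposite-involutive l)))
      (is-q (opposite l)))

  module _ (p : Fin T → Carrier) where

    average : Vec (Fin T) n → Carrier
    average W = 1# - (Σ[ i ← points ] 𝟙 (W ⊢? i) * p i)

    -- The data inside `IsTerm` are determined by `W`: the mass by independence of the enumeration,
    -- the inverse by uniqueness of inverses.
    term-value : ∀ {W t} → Independent W → IsTerm w p W t → t ≡ average W * weight W
    term-value {W} ind (q , is-q , P , (xs , enum , P≡) , invWH , invWH*∏q≡1 , t≡) = trans t≡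
      (cong₂ (λ P i → (1# - P) * i)
      (trans P≡ (Σᴸ-Enumerates-Fin (W ⊢?_)
        (Enumerates-resp (λ { (c , _ , w≗) → span c w≗ })
          (λ { (span c w≗) → c , (λ _ ¬tt → contradiction tt ¬tt) , w≗ }) enum) p))
      (inv-unique invWH*∏q≡1
        (trans (cong (λ s → weight W * fromℕ s) (∏q≡flagSize W q is-q)) (weight-independent W ind))))

    sum-of-terms : ∀ {Ws ts} → (∀ {W} → W ∈ Ws → Independent W) → Pointwise (IsTerm w p) Ws ts →
                   sumL ts ≡ (Σ[ W ← Ws ] average W * weight W)
    sum-of-terms ind []            = refl
    sum-of-terms ind (is-t ∷ is-ts) =
      cong₂ _+_ (term-value (ind (here refl)) is-t) (sum-of-terms (ind ∘ there) is-ts)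

    RHS≡E : ∀ {s} → IsRHS w p s → s ≡ E n average
    RHS≡E {s} (Ws , enum , ts , is-ts , s≡) = begin
      s
        ≡⟨ s≡ ⟩
      sumL ts
        ≡⟨ sum-of-terms (λ {W} W∈Ws → InHxn≠0⇒Independent (Equivalence.to (proj₂ enum W) W∈Ws)) is-ts ⟩
      (Σ[ W ← Ws ] average W * weight W)
        ≡⟨ Σᴸ-Enumerates (tuples-unique T n) ∈-tuples independent?
             (Enumerates-resp InHxn≠0⇒Independent Independent⇒InHxn≠0 enum) _ ⟩
      (Σ[ W ← tuples T n ] 𝟙 (independent? W) * (average W * weight W))
        ≡⟨ Σᴸ-cong (tuples T n) (λ W → drop-indicator W (independent? W)) ⟩
      (Σ[ W ← tuples T n ] weight W * average W)
        ≡⟨ ⟨∣⟩≡Σ weight average ⟨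
      E n average ∎
      where
      open ≡-Reasoning
      drop-indicator : ∀ W (ind? : Dec (Independent W)) → 𝟙 ind? * (average W * weight W) ≡ weight W * average W
      drop-indicator W (yes ind) = trans (𝟙-true-* (yes ind) ind) (*-comm _ _)
      drop-indicator W (no dep)  = trans (𝟙-false-* (no dep) dep)
        (sym (trans (cong (_* average W) (weight-dependent W dep)) (zeroˡ (average W))))

  eta≡nbc : ∀ {k} j → toℕ j ≡ 0 → IsEtaStar w k → fromℕ k ≡ ⟨ nbc ∣ (λ (W : Vec (Fin T) n) → 𝟙 (¬? (W ⊢? j))) ⟩
  eta≡nbc {k} j j≡0 (Ws , enum , length≡k) = begin
    fromℕ k
      ≡⟨ cong fromℕ length≡k ⟨
    fromℕ (length Ws)
      ≡⟨ Σᴸ-const1 Ws ⟨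
    (Σ[ _ ← Ws ] 1#)
      ≡⟨ Σᴸ-Enumerates (tuples-unique T n) ∈-tuples (λ W → noBrokenCircuit? W ×-dec ¬? (W ⊢? j))
           (Enumerates-resp (eta⇒ j≡0) (eta⇐ j≡0) enum) (λ _ → 1#) ⟩
    (Σ[ W ← tuples T n ] 𝟙 (noBrokenCircuit? W ×-dec ¬? (W ⊢? j)) * 1#)
      ≡⟨ Σᴸ-cong (tuples T n) (λ W → trans (*-identityʳ _) (𝟙-× (noBrokenCircuit? W) (¬? (W ⊢? j)))) ⟩
    (Σ[ W ← tuples T n ] nbc W * 𝟙 (¬? (W ⊢? j)))
      ≡⟨ ⟨∣⟩≡Σ nbc (λ W → 𝟙 (¬? (W ⊢? j))) ⟨
    ⟨ nbc ∣ (λ (W : Vec (Fin T) n) → 𝟙 (¬? (W ⊢? j))) ⟩ ∎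
    where open ≡-Reasoning

theorem3 : (ℝ : RealField) → let open Linear ℝ in
    ∀ (n T : ℕ) (w : Fin T → Vecℝ n) (p : Fin T → Carrier) →
    DistinctPoints w →
    (∀ x → InSpan w x) →
    (∀ i → 0# ≤ p i) →
    ∑ p ≡ 1# →
    ∀ (k : ℕ) (s : Carrier) → IsEtaStar w k → IsRHS w p s →
    fromℕ k ≡ s
-- Without points the sum of `p` is empty, and the hypothesis reads 0 = 1.
theorem3 ℝ n zero    w p _         _ _ ∑p≡1 k s _   _   = contradiction ∑p≡1 (RealField.0≢1 ℝ)
-- `zero` is the first point in the order, the one that the η tuples avoid.
theorem3 ℝ n (suc T) w p (w≢0 , _) _ _ ∑p≡1 k s eta rhs = trans (eta≡nbc zero refl eta)
  (trans (nbc-avoiding≡E-average independent-spanning p ∑p≡1 zero) (sym (RHS≡E p rhs)))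
  where open Configuration ℝ w w≢0
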